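{- The category $\mathbb{M}$ of multisets is dually equivalent to the category $\mathbb{P}$ of profinite MV-algebras and homomorphisms that reflect principal maximal ideals; that is, $\mathbb{M}$ is equivalent to $\mathbb{P}^{op}$.
   Context: An MV-algebra is an Abelian monoid $(A,\oplus,0)$ with an involution $\neg:A\to A$ such that $\neg 0\oplus x=\neg 0$ and $\neg(\neg x\oplus y)\oplus y=\neg(\neg y\oplus x)\oplus x$ for all $x,y\in A$; its order is $x\le y$ iff $\neg x\oplus y=\neg 0$. An MV-algebra is profinite if it is isomorphic to an inverse limit of an inverse system of finite MV-algebras indexed by a directed poset. An ideal is a nonempty subset closed under $\oplus$ and downward closed; a maximal ideal is a proper ideal maximal under inclusion; an ideal is principal if it is generated by a single element $a$ (i.e. it equals $\{x: x\le na \text{ for some integer } n\ge 1\}$, where $na=a\oplus\cdots\oplus a$, $n$ times). A homomorphism $\varphi:A\to B$ reflects principal maximal ideals if for every principal maximal ideal $J$ of $B$, $\varphi^{ -1}(J)$ is a principal maximal ideal of $A$. $\mathbb{P}$ is the category whose objects are profinite MV-algebras and whose morphisms are the MV-homomorphisms reflecting principal maximal ideals. A multiset is a pair $\langle X,\sigma\rangle$ with $X$ a set and $\sigma:X\to\mathbb{N}$ a map, where $\mathbb{N}=\{1,2,3,\dots\}$. A morphism $\langle X,\sigma\rangle\to\langle Y,\mu\rangle$ is a map $\varphi:X\to Y$ such that $\mu(\varphi(x))$ divides $\sigma(x)$ for all $x\in X$. These form the category $\mathbb{M}$. -}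

module Defs where

open import Algebra.Bundles using (CommutativeMonoid; RawMonoid)
open import Algebra.Definitions using (Congruent₁; Involutive; LeftZero)
import Algebra.Definitions.RawMonoid as RawMonoidDefs
open import Algebra.Morphism.Structures using (module MonoidMorphisms)
open import Algebra.Structures using (IsCommutativeMonoid)
open import Data.Fin.Base using (Fin)
open import Data.Nat.Base using (ℕ; NonZero) renaming (_≤_ to _≤ℕ_)
open import Data.Nat.Divisibility using (_∣_; ∣-refl; ∣-trans)
open import Data.Product.Base using (Σ; ∃; _×_; _,_; proj₁; proj₂)
open import Function.Base using (_∘_)
open import Function.Bundles using (Func; Inverse)
open import Function.Definitions using (Bijective)
import Function.Construct.Composition as Comp
import Function.Construct.Identity as Id
open import Level using (Level; suc; _⊔_)
open import Relation.Binary.Bundles using (Setoid; Poset)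
open import Relation.Binary.Core using (Rel)
open import Relation.Binary.Structures using (IsEquivalence)
import Relation.Binary.PropositionalEquality as ≡
open import Relation.Nullary.Negation.Core using (¬_)
open import Relation.Unary using (Pred; _∈_; _⊆_; _≐_; _⊢_; Satisfiable; Universal)

-- Sets are setoids throughout, so hom-sets carry their own equality and
-- objects are never compared for equality.

record Category (o h e : Level) : Set (suc (o ⊔ h ⊔ e)) where
  infix  4 _≈_ _⇒_
  infixr 9 _∙_
  field
    Obj       : Set o
    _⇒_       : Obj → Obj → Set h
    _≈_       : ∀ {A B} → Rel (A ⇒ B) e
    id        : ∀ {A} → A ⇒ A
    _∙_       : ∀ {A B C} → B ⇒ C → A ⇒ B → A ⇒ C
    equiv     : ∀ {A B} → IsEquivalence (_≈_ {A} {B})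
    ∙-cong    : ∀ {A B C} {f f′ : B ⇒ C} {g g′ : A ⇒ B} →
                f ≈ f′ → g ≈ g′ → f ∙ g ≈ f′ ∙ g′
    identityˡ : ∀ {A B} {f : A ⇒ B} → id ∙ f ≈ f
    identityʳ : ∀ {A B} {f : A ⇒ B} → f ∙ id ≈ f
    assoc     : ∀ {A B C D} {f : C ⇒ D} {g : B ⇒ C} {h : A ⇒ B} →
                (f ∙ g) ∙ h ≈ f ∙ (g ∙ h)

_ᵒᵖ : ∀ {o h e} → Category o h e → Category o h e
C ᵒᵖ = record
  { Obj       = Obj
  ; _⇒_       = λ A B → B ⇒ A
  ; _≈_       = _≈_
  ; id        = id
  ; _∙_       = λ f g → g ∙ f
  ; equiv     = equiv
  ; ∙-cong    = λ p q → ∙-cong q p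
  ; identityˡ = identityʳ
  ; identityʳ = identityˡ
  ; assoc     = IsEquivalence.sym equiv assoc
  }
  where open Category C

record Functor {o h e o′ h′ e′} (C : Category o h e) (D : Category o′ h′ e′)
  : Set (o ⊔ h ⊔ e ⊔ o′ ⊔ h′ ⊔ e′) where
  private
    module C = Category C
    module D = Category D
  field
    F₀     : C.Obj → D.Obj
    F₁     : ∀ {A B} → A C.⇒ B → F₀ A D.⇒ F₀ B
    F-cong : ∀ {A B} {f g : A C.⇒ B} → f C.≈ g → F₁ f D.≈ F₁ g
    F-id   : ∀ {A} → F₁ (C.id {A}) D.≈ D.id
    F-∙    : ∀ {A B C} {f : B C.⇒ C} {g : A C.⇒ B} →
             F₁ (f C.∙ g) D.≈ F₁ f D.∙ F₁ g

idF : ∀ {o h e} {C : Category o h e} → Functor C C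
idF {C = C} = record
  { F₀     = λ A → A
  ; F₁     = λ f → f
  ; F-cong = λ p → p
  ; F-id   = IsEquivalence.refl equiv
  ; F-∙    = IsEquivalence.refl equiv
  }
  where open Category C

_∘F_ : ∀ {o h e o′ h′ e′ o″ h″ e″}
       {C : Category o h e} {D : Category o′ h′ e′} {E : Category o″ h″ e″} →
       Functor D E → Functor C D → Functor C E
_∘F_ {E = E} G F = record
  { F₀     = λ A → G.F₀ (F.F₀ A)
  ; F₁     = λ f → G.F₁ (F.F₁ f)
  ; F-cong = λ p → G.F-cong (F.F-cong p)
  ; F-id   = trans (G.F-cong F.F-id) G.F-id
  ; F-∙    = trans (G.F-cong F.F-∙) G.F-∙
  }
  where
  module F = Functor F
  module G = Functor G
  trans : ∀ {A B} {f g h : Category._⇒_ E A B} →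
          Category._≈_ E f g → Category._≈_ E g h → Category._≈_ E f h
  trans = IsEquivalence.trans (Category.equiv E)

record NaturalIsomorphism {o h e o′ h′ e′}
  {C : Category o h e} {D : Category o′ h′ e′} (F G : Functor C D)
  : Set (o ⊔ h ⊔ e ⊔ o′ ⊔ h′ ⊔ e′) where
  private
    module C = Category C
    module F = Functor F
    module G = Functor G
  open Category D
  field
    η        : ∀ A → F.F₀ A ⇒ G.F₀ A
    η⁻¹      : ∀ A → G.F₀ A ⇒ F.F₀ A
    natural  : ∀ {A B} (f : A C.⇒ B) → η B ∙ F.F₁ f ≈ G.F₁ f ∙ η A
    inverseˡ : ∀ A → η⁻¹ A ∙ η A ≈ id
    inverseʳ : ∀ A → η A ∙ η⁻¹ A ≈ id

record Equivalence {o h e o′ h′ e′} (C : Category o h e) (D : Category o′ h′ e′)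
  : Set (o ⊔ h ⊔ e ⊔ o′ ⊔ h′ ⊔ e′) where
  field
    F    : Functor C D
    G    : Functor D C
    unit   : NaturalIsomorphism idF (G ∘F F)
    counit : NaturalIsomorphism (F ∘F G) idF

record Multiset (ℓ : Level) : Set (suc ℓ) where
  field
    X         : Setoid ℓ ℓ
    σ         : Func X (≡.setoid ℕ)
    σ-nonZero : ∀ x → NonZero (Func.to σ x)

record MultisetHom {ℓ : Level} (M N : Multiset ℓ) : Set ℓ where
  private
    module M = Multiset M
    module N = Multiset N
  field
    func    : Func M.X N.X
    divides : ∀ x → Func.to N.σ (Func.to func x) ∣ Func.to M.σ x

  open Func func public using (to; cong)

𝕄 : (ℓ : Level) → Category (suc ℓ) ℓ ℓ
𝕄 ℓ = record
  { Obj       = Multiset ℓ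
  ; _⇒_       = MultisetHom
  ; _≈_       = λ {M} {N} φ ψ → ∀ x → Setoid._≈_ (X N) (to φ x) (to ψ x)
  ; id        = λ {M} → record
      { func = Id.function (X M) ; divides = λ _ → ∣-refl }
  ; _∙_       = λ φ ψ → record
      { func    = Comp.function (func ψ) (func φ)
      ; divides = λ x → ∣-trans (divides φ (to ψ x)) (divides ψ x)
      }
  ; equiv     = λ {M} {N} → record
      { refl  = λ x → Setoid.refl (X N)
      ; sym   = λ p x → Setoid.sym (X N) (p x)
      ; trans = λ p q x → Setoid.trans (X N) (p x) (q x)
      }
  ; ∙-cong    = λ {A} {B} {C} {φ} {φ′} {ψ} {ψ′} p q x →
      Setoid.trans (X C) (cong φ (q x)) (p (to ψ′ x))
  ; identityˡ = λ {A} {B} x → Setoid.refl (X B)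
  ; identityʳ = λ {A} {B} x → Setoid.refl (X B)
  ; assoc     = λ {A} {B} {C} {D} x → Setoid.refl (X D)
  }
  where
  open Multiset
  open MultisetHom

record MVAlgebra (ℓ : Level) : Set (suc ℓ) where
  infix  4 _≈_ _≤_
  infixl 6 _⊕_
  infix  8 ~_
  field
    Carrier             : Set ℓ
    _≈_                 : Rel Carrier ℓ
    _⊕_                 : Carrier → Carrier → Carrier
    0#                  : Carrier
    ~_                  : Carrier → Carrier
    isCommutativeMonoid : IsCommutativeMonoid _≈_ _⊕_ 0#
    ~-cong              : Congruent₁ _≈_ ~_
    ~-involutive        : Involutive _≈_ ~_
    ~0-zeroˡ            : LeftZero _≈_ (~ 0#) _⊕_
    ~⊕-exchange         : ∀ x y → (~ (~ x ⊕ y) ⊕ y) ≈ (~ (~ y ⊕ x) ⊕ x)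

  open IsCommutativeMonoid isCommutativeMonoid public
    using (isEquivalence; setoid; refl; sym; trans; assoc; comm; identity; ∙-cong)

  rawMonoid : RawMonoid ℓ ℓ
  rawMonoid = CommutativeMonoid.rawMonoid
    (record { isCommutativeMonoid = isCommutativeMonoid })

  _≤_ : Rel Carrier ℓ
  x ≤ y = (~ x ⊕ y) ≈ ~ 0#

  infixr 7 _·_
  _·_ : ℕ → Carrier → Carrier
  _·_ = RawMonoidDefs._×_ rawMonoid

  -- Downward closure makes an ideal respect _≈_, since x ≈ y implies x ≤ y.
  record IsIdeal (I : Pred Carrier ℓ) : Set ℓ where
    field
      nonempty    : Satisfiable I
      ⊕-closed    : ∀ {x y} → x ∈ I → y ∈ I → x ⊕ y ∈ I
      down-closed : ∀ {x y} → x ≤ y → y ∈ I → x ∈ I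

  record IsMaximalIdeal (I : Pred Carrier ℓ) : Set (suc ℓ) where
    field
      isIdeal : IsIdeal I
      proper  : ¬ Universal I
      maximal : ∀ (K : Pred Carrier ℓ) → IsIdeal K → ¬ Universal K →
                I ⊆ K → I ≐ K

  ⟨_⟩ : Carrier → Pred Carrier ℓ
  ⟨ a ⟩ x = ∃ λ n → 1 ≤ℕ n × x ≤ n · a

  IsPrincipal : Pred Carrier ℓ → Set ℓ
  IsPrincipal I = ∃ λ a → I ≐ ⟨ a ⟩

  IsPrincipalMaximalIdeal : Pred Carrier ℓ → Set (suc ℓ)
  IsPrincipalMaximalIdeal I = IsMaximalIdeal I × IsPrincipal I

IsFinite : ∀ {ℓ} → MVAlgebra ℓ → Set ℓ
IsFinite A = ∃ λ n → Inverse (≡.setoid (Fin n)) (MVAlgebra.setoid A)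

record MVHom {ℓ : Level} (A B : MVAlgebra ℓ) : Set ℓ where
  private
    module A = MVAlgebra A
    module B = MVAlgebra B
  open MonoidMorphisms A.rawMonoid B.rawMonoid
  field
    ⟦_⟧                  : A.Carrier → B.Carrier
    isMonoidHomomorphism : IsMonoidHomomorphism ⟦_⟧
    ~-homo               : ∀ x → ⟦ A.~ x ⟧ B.≈ B.~ ⟦ x ⟧

  open IsMonoidHomomorphism isMonoidHomomorphism public
    using (⟦⟧-cong; homo; ε-homo)

idMV : ∀ {ℓ} {A : MVAlgebra ℓ} → MVHom A A
idMV {A = A} = record
  { ⟦_⟧                  = λ x → x
  ; isMonoidHomomorphism = record
      { isMagmaHomomorphism = record
          { isRelHomomorphism = record { cong = λ p → p }
          ; homo              = λ _ _ → refl
          }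
      ; ε-homo = refl
      }
  ; ~-homo               = λ _ → refl
  }
  where open MVAlgebra A

_∘MV_ : ∀ {ℓ} {A B C : MVAlgebra ℓ} → MVHom B C → MVHom A B → MVHom A C
_∘MV_ {C = C} g f = record
  { ⟦_⟧                  = g.⟦_⟧ ∘ f.⟦_⟧
  ; isMonoidHomomorphism = record
      { isMagmaHomomorphism = record
          { isRelHomomorphism = record { cong = λ p → g.⟦⟧-cong (f.⟦⟧-cong p) }
          ; homo              = λ x y → trans (g.⟦⟧-cong (f.homo x y)) (g.homo _ _)
          }
      ; ε-homo = trans (g.⟦⟧-cong f.ε-homo) g.ε-homo
      }
  ; ~-homo               = λ x → trans (g.⟦⟧-cong (f.~-homo x)) (g.~-homo _)
  }
  where
  open MVAlgebra C
  module f = MVHom f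
  module g = MVHom g

IsIsomorphism : ∀ {ℓ} {A B : MVAlgebra ℓ} → MVHom A B → Set ℓ
IsIsomorphism {A = A} {B} f =
  Bijective (MVAlgebra._≈_ A) (MVAlgebra._≈_ B) (MVHom.⟦_⟧ f)

_≅_ : ∀ {ℓ} → MVAlgebra ℓ → MVAlgebra ℓ → Set ℓ
A ≅ B = Σ (MVHom A B) IsIsomorphism

-- Convention: directed posets are nonempty.
record IsDirected {ℓ : Level} (P : Poset ℓ ℓ ℓ) : Set ℓ where
  open Poset P
  field
    inhabitant : Carrier
    upperBound : ∀ i j → ∃ λ k → i ≤ k × j ≤ k

-- map-id and map-∘ range over all proofs of the order relations involved,
-- so map does not depend on the choice of proof of i ≤ j.
record FiniteInverseSystem (ℓ : Level) : Set (suc ℓ) where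
  field
    index    : Poset ℓ ℓ ℓ
    directed : IsDirected index
  open Poset index using (_≤_) renaming (Carrier to I)
  field
    alg    : I → MVAlgebra ℓ
    finite : ∀ i → IsFinite (alg i)
    map    : ∀ {i j} → i ≤ j → MVHom (alg j) (alg i)
    map-id : ∀ {i} (p : i ≤ i) (x : MVAlgebra.Carrier (alg i)) →
             MVAlgebra._≈_ (alg i) (MVHom.⟦ map p ⟧ x) x
    map-∘  : ∀ {i j k} (p : i ≤ j) (q : j ≤ k) (r : i ≤ k)
             (x : MVAlgebra.Carrier (alg k)) →
             MVAlgebra._≈_ (alg i) (MVHom.⟦ map r ⟧ x)
                                   (MVHom.⟦ map p ⟧ (MVHom.⟦ map q ⟧ x))

-- The subalgebra of the product of all alg i formed by the compatible families.
limit : ∀ {ℓ} → FiniteInverseSystem ℓ → MVAlgebra ℓ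
limit S = record
  { Carrier = Σ (∀ i → A.Carrier i) λ a →
              ∀ {i j} (p : i ≤ j) → A._≈_ i (m.⟦_⟧ p (a j)) (a i)
  ; _≈_     = λ a b → ∀ i → A._≈_ i (proj₁ a i) (proj₁ b i)
  ; _⊕_     = λ (a , a-comp) (b , b-comp) →
      (λ i → A._⊕_ i (a i) (b i)) ,
      λ {i} {j} p → A.trans i (m.homo p (a j) (b j)) (A.∙-cong i (a-comp p) (b-comp p))
  ; 0#      = (λ i → A.0# i) , λ p → m.ε-homo p
  ; ~_      = λ (a , a-comp) →
      (λ i → A.~_ i (a i)) ,
      λ {i} {j} p → A.trans i (m.~-homo p (a j)) (A.~-cong i (a-comp p))
  ; isCommutativeMonoid = record
      { isMonoid = record
          { isSemigroup = record
              { isMagma = record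
                  { isEquivalence = record
                      { refl  = λ i → A.refl i
                      ; sym   = λ p i → A.sym i (p i)
                      ; trans = λ p q i → A.trans i (p i) (q i)
                      }
                  ; ∙-cong = λ p q i → A.∙-cong i (p i) (q i)
                  }
              ; assoc = λ a b c i → A.assoc i _ _ _
              }
          ; identity = (λ a i → proj₁ (A.identity i) _) ,
                       (λ a i → proj₂ (A.identity i) _)
          }
      ; comm = λ a b i → A.comm i _ _
      }
  ; ~-cong       = λ p i → A.~-cong i (p i)
  ; ~-involutive = λ a i → A.~-involutive i _
  ; ~0-zeroˡ     = λ a i → A.~0-zeroˡ i _
  ; ~⊕-exchange  = λ a b i → A.~⊕-exchange i _ _
  }
  where
  open FiniteInverseSystem S
  open Poset index using (_≤_)
  module A i = MVAlgebra (alg i)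
  module m {i j} (p : i ≤ j) = MVHom (map p)

IsProfinite : ∀ {ℓ} → MVAlgebra ℓ → Set (suc ℓ)
IsProfinite {ℓ} A = Σ (FiniteInverseSystem ℓ) λ S → A ≅ limit S

ReflectsPrincipalMaximalIdeals : ∀ {ℓ} {A B : MVAlgebra ℓ} → MVHom A B → Set (suc ℓ)
ReflectsPrincipalMaximalIdeals {ℓ} {A} {B} φ =
  ∀ (J : Pred (MVAlgebra.Carrier B) ℓ) →
  MVAlgebra.IsPrincipalMaximalIdeal B J →
  MVAlgebra.IsPrincipalMaximalIdeal A (MVHom.⟦_⟧ φ ⊢ J)

ℙ : (ℓ : Level) → Category (suc ℓ) (suc ℓ) ℓ
ℙ ℓ = record
  { Obj       = Σ (MVAlgebra ℓ) IsProfinite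
  ; _⇒_       = λ (A , _) (B , _) → Σ (MVHom A B) ReflectsPrincipalMaximalIdeals
  ; _≈_       = λ {_} {(B , _)} (φ , _) (ψ , _) →
                ∀ x → MVAlgebra._≈_ B (⟦ φ ⟧ x) (⟦ ψ ⟧ x)
  ; id        = idMV , λ J pm → pm
  ; _∙_       = λ (φ , φ-refl) (ψ , ψ-refl) →
                φ ∘MV ψ , λ J pm → ψ-refl (⟦ φ ⟧ ⊢ J) (φ-refl J pm)
  ; equiv     = λ {_} {(B , _)} → record
      { refl  = λ x → MVAlgebra.refl B
      ; sym   = λ p x → MVAlgebra.sym B (p x)
      ; trans = λ p q x → MVAlgebra.trans B (p x) (q x)
      }
  ; ∙-cong    = λ {_} {_} {(C , _)} {(φ , _)} {_} {_} {(ψ′ , _)} p q x →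
                MVAlgebra.trans C (⟦⟧-cong φ (q x)) (p (⟦ ψ′ ⟧ x))
  ; identityˡ = λ {_} {(B , _)} x → MVAlgebra.refl B
  ; identityʳ = λ {_} {(B , _)} x → MVAlgebra.refl B
  ; assoc     = λ {_} {_} {_} {(D , _)} x → MVAlgebra.refl D
  }
  where open MVHom

{-# OPTIONS --safe #-}
module Submission where

open import Defs
open import Algebra.Bundles using (CommutativeMonoid)
import Algebra.Properties.Monoid.Mult as Mult
open import Axiom.ExcludedMiddle using (ExcludedMiddle)
open import Data.Fin.Base using (Fin; zero; suc; toℕ; fromℕ<; combine)
import Data.Fin.Properties as Finₚ
open import Data.List.Base using (List; []; _∷_; _++_; [_]; map; allFin)
open import Data.List.Membership.Propositional.Properties using (∈-allFin; ∈-map⁺)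
open import Data.List.Relation.Unary.All as All using (All; []; _∷_)
import Data.List.Relation.Unary.All.Properties as Allₚ
open import Data.List.Relation.Unary.Any using (here)
open import Data.Nat.Base using (ℕ; zero; suc; NonZero; z≤n; s≤s; _+_; _*_; _∸_; _⊓_; _⊔_; _<_;
  >-nonZero; >-nonZero⁻¹; ≢-nonZero; ≢-nonZero⁻¹) renaming (_≤_ to _≤ℕ_)
open import Data.Nat.Divisibility using (_∣_; divides; _∣0; ∣m∣n⇒∣m+n; ∣-refl; ∣-reflexive)
open import Data.Nat.Induction using (<-wellFounded; Acc; acc)
import Data.Nat.Properties as ℕₚ
open import Data.Nat.Solver using (module +-*-Solver)
open import Data.Product.Base using (Σ; ∃; _×_; _,_; proj₁; proj₂)
open import Data.Sum.Base using (_⊎_; inj₁; inj₂; [_,_]′)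
open import Function.Base using (case_of_)
open import Function.Bundles using (Func; Inverse)
import Function.Construct.Composition as Comp
open import Level using (Level; Lift; lift; lower)
import Level
open import Relation.Binary.Bundles using (Setoid; Poset)
import Relation.Binary.Construct.On as On
open import Relation.Binary.Core using (Rel)
open import Relation.Binary.PropositionalEquality as ≡ using (_≡_)
import Relation.Binary.Reasoning.Setoid as SetoidReasoning
open import Relation.Binary.Structures using (IsEquivalence)
open import Relation.Nullary.Decidable as Dec using (yes; no; decidable-stable)
open import Relation.Nullary.Negation.Core using (¬_; contradiction)

-- A multiset ⟨X, σ⟩ corresponds to the product of the chains with σ(x) + 1
-- elements, x ∈ X, and a profinite algebra A to the multiset of its points:
-- surjections onto finite chains with principal kernel, i.e. its principal
-- maximal ideals. A point is determined by its kernel, so all naturality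
-- conditions on points reduce to inclusions of kernels.
--
-- The points of a product are exactly its coordinates: if a generator a of a
-- principal maximal ideal vanished nowhere, the geometric mean of a and 1
-- would generate a proper ideal strictly above it.
--
-- In an inverse limit of finite algebras, a ∨-closed set has a supremum which
-- in each finite factor agrees with a member of the set. Applied to a kernel,
-- this shows that homomorphisms to chains factoring through a finite factor
-- have principal kernels, whence points separate elements, because they do so
-- in finite algebras; applied to the elements below a prescribed family of
-- values at the points, it yields an element with these values.

private
  variable
    ℓ : Level

-- Truncated arithmetic on natural numbers

n⊓[n⊓x+y]≡n⊓[x+y] : ∀ n x y → n ⊓ (n ⊓ x + y) ≡ n ⊓ (x + y)
n⊓[n⊓x+y]≡n⊓[x+y] n x y = begin
  n ⊓ (n ⊓ x + y)             ≡⟨ ≡.cong (n ⊓_) (ℕₚ.+-distribʳ-⊓ y n x) ⟩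
  n ⊓ ((n + y) ⊓ (x + y))     ≡⟨ ℕₚ.⊓-assoc n (n + y) (x + y) ⟨
  n ⊓ (n + y) ⊓ (x + y)       ≡⟨ ≡.cong (_⊓ (x + y)) (ℕₚ.m≤n⇒m⊓n≡m (ℕₚ.m≤m+n n y)) ⟩
  n ⊓ (x + y)                 ∎
  where open ≡.≡-Reasoning

-- The left side is the MV-difference of `a` and `b` computed in the chain 0, ..., `n`.
n∸n⊓[n∸a+b]≡a∸b : ∀ {n a} b → a ≤ℕ n → n ∸ n ⊓ (n ∸ a + b) ≡ a ∸ b
n∸n⊓[n∸a+b]≡a∸b {n} {a} b a≤n = begin
  n ∸ n ⊓ (n ∸ a + b)                ≡⟨ ℕₚ.∸-distribˡ-⊓-⊔ n n (n ∸ a + b) ⟩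
  (n ∸ n) ⊔ (n ∸ (n ∸ a + b))       ≡⟨ ≡.cong₂ _⊔_ (ℕₚ.n∸n≡0 n) (≡.sym (ℕₚ.∸-+-assoc n (n ∸ a) b)) ⟩
  n ∸ (n ∸ a) ∸ b                    ≡⟨ ≡.cong (_∸ b) (ℕₚ.m∸[m∸n]≡n a≤n) ⟩
  a ∸ b                              ∎
  where
  open ≡.≡-Reasoning

-- Both sides are the maximum of `m` and `n`; this is the exchange axiom in a chain.
m∸n+n≡n∸m+m : ∀ m n → m ∸ n + n ≡ n ∸ m + m
m∸n+n≡n∸m+m zero    zero    = ≡.refl
m∸n+n≡n∸m+m zero    (suc n) = ≡.sym (ℕₚ.+-identityʳ _)
m∸n+n≡n∸m+m (suc m) zero    = ℕₚ.+-identityʳ _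
m∸n+n≡n∸m+m (suc m) (suc n) = ≡.trans (ℕₚ.+-suc (m ∸ n) n)
  (≡.trans (≡.cong suc (m∸n+n≡n∸m+m m n)) (≡.sym (ℕₚ.+-suc (n ∸ m) m)))

m*n≡0⇒n≡0 : ∀ m n .{{_ : NonZero m}} → m * n ≡ 0 → n ≡ 0
m*n≡0⇒n≡0 m n eq = ℕₚ.m*n≡0⇒m≡0 n m (≡.trans (ℕₚ.*-comm n m) eq)

-- Algebra of MV-algebras

module MVProperties (A : MVAlgebra ℓ) where
  open MVAlgebra A
  open SetoidReasoning setoid

  commutativeMonoid : CommutativeMonoid ℓ ℓ
  commutativeMonoid = record { isCommutativeMonoid = isCommutativeMonoid }

  open Mult (CommutativeMonoid.monoid commutativeMonoid) public
    using () renaming (×-homo-+ to ·-homo-+; ×-congʳ to ·-congʳ)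

  infixl 6 _⊖_ _∨_
  1# : Carrier
  1# = ~ 0#

  _⊖_ : Carrier → Carrier → Carrier
  x ⊖ y = ~ (~ x ⊕ y)

  -- The lattice join; the exchange axiom is its commutativity.
  _∨_ : Carrier → Carrier → Carrier
  x ∨ y = x ⊖ y ⊕ y

  ⊕-congˡ : ∀ {x y z} → y ≈ z → x ⊕ y ≈ x ⊕ z
  ⊕-congˡ = ∙-cong refl

  ⊕-congʳ : ∀ {x y z} → y ≈ z → y ⊕ x ≈ z ⊕ x
  ⊕-congʳ y≈z = ∙-cong y≈z refl

  ⊖-cong : ∀ {x y z w} → x ≈ y → z ≈ w → x ⊖ z ≈ y ⊖ w
  ⊖-cong x≈y z≈w = ~-cong (∙-cong (~-cong x≈y) z≈w)

  identityˡ : ∀ x → 0# ⊕ x ≈ x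
  identityˡ = proj₁ identity

  identityʳ : ∀ x → x ⊕ 0# ≈ x
  identityʳ = proj₂ identity

  1-zeroʳ : ∀ x → x ⊕ 1# ≈ 1#
  1-zeroʳ x = trans (comm x 1#) (~0-zeroˡ x)

  ~-injective : ∀ {x y} → ~ x ≈ ~ y → x ≈ y
  ~-injective {x} {y} ~x≈~y = trans (sym (~-involutive x)) (trans (~-cong ~x≈~y) (~-involutive y))

  -- Exchange at `1#` and `x`: one side collapses to `~ x ⊕ x`, the other is absorbed by `1#`.
  ≤-refl : ∀ {x} → x ≤ x
  ≤-refl {x} = begin
    ~ x ⊕ x                    ≈⟨ ⊕-congʳ (~-cong (identityˡ x)) ⟨
    ~ (0# ⊕ x) ⊕ x             ≈⟨ ⊕-congʳ (~-cong (⊕-congʳ (~-involutive 0#))) ⟨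
    ~ (~ 1# ⊕ x) ⊕ x           ≈⟨ ~⊕-exchange 1# x ⟩
    ~ (~ x ⊕ 1#) ⊕ 1#          ≈⟨ 1-zeroʳ _ ⟩
    1#                         ∎

  ≤-reflexive : ∀ {x y} → x ≈ y → x ≤ y
  ≤-reflexive x≈y = trans (⊕-congʳ (~-cong x≈y)) ≤-refl

  0≤x : ∀ x → 0# ≤ x
  0≤x x = ~0-zeroˡ x

  x≤1 : ∀ x → x ≤ 1#
  x≤1 x = 1-zeroʳ (~ x)

  x≤0⇒x≈0 : ∀ {x} → x ≤ 0# → x ≈ 0#
  x≤0⇒x≈0 x≤0 = ~-injective (trans (sym (identityʳ _)) x≤0)

  x≤y⇒x⊖y≈0 : ∀ {x y} → x ≤ y → x ⊖ y ≈ 0#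
  x≤y⇒x⊖y≈0 x≤y = trans (~-cong x≤y) (~-involutive 0#)

  x⊖y≈0⇒x≤y : ∀ {x y} → x ⊖ y ≈ 0# → x ≤ y
  x⊖y≈0⇒x≤y eq = trans (sym (~-involutive _)) (~-cong eq)

  x≤y⇒x∨y≈y : ∀ {x y} → x ≤ y → x ∨ y ≈ y
  x≤y⇒x∨y≈y {x} {y} x≤y = trans (⊕-congʳ (x≤y⇒x⊖y≈0 x≤y)) (identityˡ y)

  x≤y⇒y⊖x⊕x≈y : ∀ {x y} → x ≤ y → y ⊖ x ⊕ x ≈ y
  x≤y⇒y⊖x⊕x≈y {x} {y} x≤y = trans (~⊕-exchange y x) (x≤y⇒x∨y≈y x≤y)

  ≤-antisym : ∀ {x y} → x ≤ y → y ≤ x → x ≈ y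
  ≤-antisym x≤y y≤x = trans (sym (x≤y⇒x∨y≈y y≤x)) (x≤y⇒y⊖x⊕x≈y x≤y)

  x≤y⊕x : ∀ x y → x ≤ y ⊕ x
  x≤y⊕x x y = begin
    ~ x ⊕ (y ⊕ x)       ≈⟨ ⊕-congˡ (comm y x) ⟩
    ~ x ⊕ (x ⊕ y)       ≈⟨ assoc _ _ _ ⟨
    ~ x ⊕ x ⊕ y         ≈⟨ ⊕-congʳ ≤-refl ⟩
    1# ⊕ y              ≈⟨ ~0-zeroˡ y ⟩
    1#                  ∎

  ≤-respʳ : ∀ {x y z} → y ≈ z → x ≤ y → x ≤ z
  ≤-respʳ y≈z x≤y = trans (⊕-congˡ (sym y≈z)) x≤y

  ≤-respˡ : ∀ {x y z} → x ≈ y → x ≤ z → y ≤ z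
  ≤-respˡ x≈y x≤z = trans (⊕-congʳ (~-cong (sym x≈y))) x≤z

  ≤-trans : ∀ {x y z} → x ≤ y → y ≤ z → x ≤ z
  ≤-trans {x} {y} {z} x≤y y≤z = begin
    ~ x ⊕ z               ≈⟨ ⊕-congˡ (trans (comm y _) (x≤y⇒y⊖x⊕x≈y y≤z)) ⟨
    ~ x ⊕ (y ⊕ (z ⊖ y))   ≈⟨ assoc _ _ _ ⟨
    ~ x ⊕ y ⊕ (z ⊖ y)     ≈⟨ ⊕-congʳ x≤y ⟩
    1# ⊕ (z ⊖ y)          ≈⟨ ~0-zeroˡ _ ⟩
    1#                    ∎

  y≤x∨y : ∀ x y → y ≤ x ∨ y
  y≤x∨y x y = x≤y⊕x y (x ⊖ y)

  x≤x∨y : ∀ x y → x ≤ x ∨ y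
  x≤x∨y x y = ≤-respʳ (~⊕-exchange y x) (y≤x∨y y x)

  ⊖-residualʳ : ∀ {x y z} → x ≤ y ⊕ z → x ⊖ y ≤ z
  ⊖-residualʳ x≤y⊕z = trans (⊕-congʳ (~-involutive _)) (trans (assoc _ _ _) x≤y⊕z)

  ⊕-monoʳ-≤ : ∀ {x y} z → x ≤ y → x ⊕ z ≤ y ⊕ z
  ⊕-monoʳ-≤ {x} {y} z x≤y = ≤-respʳ (begin
    y ⊖ x ⊕ (x ⊕ z)   ≈⟨ assoc _ _ _ ⟨
    y ⊖ x ⊕ x ⊕ z     ≈⟨ ⊕-congʳ (x≤y⇒y⊖x⊕x≈y x≤y) ⟩
    y ⊕ z             ∎) (x≤y⊕x (x ⊕ z) (y ⊖ x))

  ⊕-mono-≤ : ∀ {x y z w} → x ≤ y → z ≤ w → x ⊕ z ≤ y ⊕ w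
  ⊕-mono-≤ {x} {y} {z} {w} x≤y z≤w = ≤-trans (⊕-monoʳ-≤ z x≤y)
    (≤-respʳ (comm w y) (≤-respˡ (comm z y) (⊕-monoʳ-≤ y z≤w)))

  ~-anti-≤ : ∀ {x y} → x ≤ y → ~ y ≤ ~ x
  ~-anti-≤ {x} {y} x≤y = trans (⊕-congʳ (~-involutive y)) (trans (comm y _) x≤y)

  ⊖-identityʳ : ∀ x → x ⊖ 0# ≈ x
  ⊖-identityʳ x = trans (~-cong (identityʳ _)) (~-involutive x)

  x⊖y≤x : ∀ x y → x ⊖ y ≤ x
  x⊖y≤x x y = ⊖-residualʳ (x≤y⊕x x y)

  ⊖-monoʳ-≤ : ∀ {x y} z → x ≤ y → z ⊖ y ≤ z ⊖ x
  ⊖-monoʳ-≤ z x≤y = ~-anti-≤ (⊕-mono-≤ ≤-refl x≤y)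

  ⊖-⊖-assoc : ∀ x y z → x ⊖ y ⊖ z ≈ x ⊖ (y ⊕ z)
  ⊖-⊖-assoc x y z = ~-cong (trans (⊕-congʳ (~-involutive _)) (assoc _ _ _))

  ~x⊖~y≈y⊖x : ∀ x y → ~ x ⊖ ~ y ≈ y ⊖ x
  ~x⊖~y≈y⊖x x y = ~-cong (trans (⊕-congʳ (~-involutive x)) (comm x _))

  -- Under complementation this becomes `x≤y⇒y⊖x⊕x≈y` for `~ y ≤ ~ x`.
  x≤y⇒y⊖[y⊖x]≈x : ∀ {x y} → x ≤ y → y ⊖ (y ⊖ x) ≈ x
  x≤y⇒y⊖[y⊖x]≈x {x} {y} x≤y = ~-injective (begin
    ~ (y ⊖ (y ⊖ x))         ≈⟨ ~-involutive _ ⟩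
    ~ y ⊕ (y ⊖ x)           ≈⟨ comm _ _ ⟩
    y ⊖ x ⊕ ~ y             ≈⟨ ⊕-congʳ (~x⊖~y≈y⊖x x y) ⟨
    ~ x ⊖ ~ y ⊕ ~ y         ≈⟨ x≤y⇒y⊖x⊕x≈y (~-anti-≤ x≤y) ⟩
    ~ x                     ∎)

  -- The left side is the meet of `x` and `y`.
  x⊖[x⊖y]≤y : ∀ x y → x ⊖ (x ⊖ y) ≤ y
  x⊖[x⊖y]≤y x y = ⊖-residualʳ (x≤x∨y x y)

  ⟨⟩-containing : ∀ {x a} → x ≤ a → ⟨ a ⟩ x
  ⟨⟩-containing x≤a = 1 , s≤s z≤n , ≤-respʳ (sym (identityʳ _)) x≤a

  0∈ideal : ∀ {I} → IsIdeal I → I 0#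
  0∈ideal isIdeal = down-closed (0≤x _) (proj₂ nonempty)
    where open IsIdeal isIdeal

  -- Quotients keep the carrier and enlarge the equality, so the laws carry over. Used for quotients
  -- by ideals and for finite restrictions of a product.
  coarsen : (_∼_ : Rel Carrier ℓ) → IsEquivalence _∼_ → (∀ {x y} → x ≈ y → x ∼ y) →
            (∀ {x y z w} → x ∼ y → z ∼ w → (x ⊕ z) ∼ (y ⊕ w)) →
            (∀ {x y} → x ∼ y → (~ x) ∼ (~ y)) → MVAlgebra ℓ
  coarsen _∼_ ∼-equiv ≈⇒∼ ⊕-cong∼ ~-cong∼ = record
    { Carrier             = Carrier
    ; _≈_                 = _∼_
    ; _⊕_                 = _⊕_
    ; 0#                  = 0#
    ; ~_                  = ~_
    ; isCommutativeMonoid = record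
        { isMonoid = record
            { isSemigroup = record
                { isMagma = record { isEquivalence = ∼-equiv ; ∙-cong = ⊕-cong∼ }
                ; assoc   = λ x y z → ≈⇒∼ (assoc x y z)
                }
            ; identity = (λ x → ≈⇒∼ (identityˡ x)) , (λ x → ≈⇒∼ (identityʳ x))
            }
        ; comm = λ x y → ≈⇒∼ (comm x y)
        }
    ; ~-cong              = ~-cong∼
    ; ~-involutive        = λ x → ≈⇒∼ (~-involutive x)
    ; ~0-zeroˡ            = λ x → ≈⇒∼ (~0-zeroˡ x)
    ; ~⊕-exchange         = λ x y → ≈⇒∼ (~⊕-exchange x y)
    }

-- Homomorphisms and isomorphisms

module MVHomProperties {A B : MVAlgebra ℓ} (φ : MVHom A B) where
  private
    module A = MVAlgebra A
    module B = MVAlgebra B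
    module Bₚ = MVProperties B
  open MVHom φ

  1-homo : ⟦ A.~ A.0# ⟧ B.≈ B.~ B.0#
  1-homo = B.trans (~-homo A.0#) (B.~-cong ε-homo)

  ~⊕-homo : ∀ x y → ⟦ A.~ x A.⊕ y ⟧ B.≈ B.~ ⟦ x ⟧ B.⊕ ⟦ y ⟧
  ~⊕-homo x y = B.trans (homo _ y) (Bₚ.⊕-congʳ (~-homo x))

  mono-≤ : ∀ {x y} → x A.≤ y → ⟦ x ⟧ B.≤ ⟦ y ⟧
  mono-≤ {x} {y} x≤y = B.trans (B.sym (~⊕-homo x y)) (B.trans (⟦⟧-cong x≤y) 1-homo)

  ·-homo : ∀ n x → ⟦ n A.· x ⟧ B.≈ n B.· ⟦ x ⟧
  ·-homo zero    x = ε-homo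
  ·-homo (suc n) x = B.trans (homo x _) (Bₚ.⊕-congˡ (·-homo n x))

  preimage-isIdeal : ∀ {I} → B.IsIdeal I → A.IsIdeal (λ x → I ⟦ x ⟧)
  preimage-isIdeal isIdeal = record
    { nonempty    = A.0# , down-closed (Bₚ.≤-reflexive ε-homo) (Bₚ.0∈ideal isIdeal)
    ; ⊕-closed    = λ p q → down-closed (Bₚ.≤-reflexive (homo _ _)) (⊕-closed p q)
    ; down-closed = λ x≤y → down-closed (mono-≤ x≤y)
    }
    where open B.IsIdeal isIdeal

module IsomorphismProperties {A B : MVAlgebra ℓ} (φ : MVHom A B) (iso : IsIsomorphism φ) where
  private
    module A = MVAlgebra A
    module B = MVAlgebra B
    module Aₚ = MVProperties A
    module Bₚ = MVProperties B
  open MVHom φ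
  open MVHomProperties φ

  injective : ∀ {x y} → ⟦ x ⟧ B.≈ ⟦ y ⟧ → x A.≈ y
  injective = proj₁ iso

  from : B.Carrier → A.Carrier
  from y = proj₁ (proj₂ iso y)

  to∘from : ∀ y → ⟦ from y ⟧ B.≈ y
  to∘from y = proj₂ (proj₂ iso y) A.refl

  from∘to : ∀ x → from ⟦ x ⟧ A.≈ x
  from∘to x = injective (to∘from ⟦ x ⟧)

  inverse : MVHom B A
  inverse = record
    { ⟦_⟧                  = from
    ; isMonoidHomomorphism = record
        { isMagmaHomomorphism = record
            { isRelHomomorphism = record
                { cong = λ x≈y → injective (B.trans (to∘from _) (B.trans x≈y (B.sym (to∘from _)))) }
            ; homo = λ x y → injective (B.trans (to∘from _) (B.sym
                (B.trans (homo _ _) (B.∙-cong (to∘from x) (to∘from y)))))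
            }
        ; ε-homo = injective (B.trans (to∘from _) (B.sym ε-homo))
        }
    ; ~-homo               = λ x → injective (B.trans (to∘from _) (B.sym
        (B.trans (~-homo _) (B.~-cong (to∘from x)))))
    }

  inverse-isIsomorphism : IsIsomorphism inverse
  inverse-isIsomorphism =
    (λ {x} {y} eq → B.trans (B.sym (to∘from x)) (B.trans (⟦⟧-cong eq) (to∘from y))) ,
    (λ x → ⟦ x ⟧ , λ z≈ → A.trans (MVHom.⟦⟧-cong inverse z≈) (from∘to x))

  cancel-≤ : ∀ {x y} → ⟦ x ⟧ B.≤ ⟦ y ⟧ → x A.≤ y
  cancel-≤ {x} {y} le = injective (B.trans (~⊕-homo x y) (B.trans le (B.sym 1-homo)))

  ⟨⟩-reflects : ∀ {x a} → B.⟨ ⟦ a ⟧ ⟩ ⟦ x ⟧ → A.⟨ a ⟩ x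
  ⟨⟩-reflects {a = a} (n , 1≤n , le) = n , 1≤n , cancel-≤ (Bₚ.≤-respʳ (B.sym (·-homo n a)) le)

  ⟨⟩-preserves : ∀ {x a} → A.⟨ a ⟩ x → B.⟨ ⟦ a ⟧ ⟩ ⟦ x ⟧
  ⟨⟩-preserves {a = a} (n , 1≤n , le) = n , 1≤n , Bₚ.≤-respʳ (·-homo n a) (mono-≤ le)

  -- A proper ideal `K` above the preimage of `J` is pulled back along `inverse`, where maximality
  -- of `J` applies; `from a` generates the preimage.
  reflects : ReflectsPrincipalMaximalIdeals φ
  reflects J (J-maximal , a , J⊆⟨a⟩ , ⟨a⟩⊆J) = record
    { isIdeal = preimage-isIdeal isIdeal
    ; proper  = λ univ → proper λ y → J-resp (to∘from y) (univ (from y))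
    ; maximal = λ K K-ideal K-proper J⊆K →
        let module K = A.IsIdeal K-ideal
            K-resp : ∀ {x y} → x A.≈ y → K x → K y
            K-resp x≈y = K.down-closed (Aₚ.≤-reflexive (A.sym x≈y))
        in J⊆K , λ {x} x∈K → proj₂ (maximal (λ y → K (from y))
             (MVHomProperties.preimage-isIdeal inverse K-ideal)
             (λ univ → K-proper λ x → K-resp (from∘to x) (univ ⟦ x ⟧))
             (λ {y} y∈J → J⊆K (J-resp (B.sym (to∘from y)) y∈J)))
             (K-resp (A.sym (from∘to x)) x∈K)
    } , from a ,
    (λ {x} x∈J → ⟨⟩-reflects (⟨⟩-resp (J⊆⟨a⟩ x∈J))) ,
    (λ {x} x∈⟨⟩ → ⟨a⟩⊆J (⟨⟩-resp′ (⟨⟩-preserves x∈⟨⟩)))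
    where
    open B.IsMaximalIdeal J-maximal
    J-resp : ∀ {x y} → x B.≈ y → J x → J y
    J-resp x≈y = B.IsIdeal.down-closed isIdeal (Bₚ.≤-reflexive (B.sym x≈y))
    ⟨⟩-resp : ∀ {x} → B.⟨ a ⟩ x → B.⟨ ⟦ from a ⟧ ⟩ x
    ⟨⟩-resp (n , 1≤n , le) = n , 1≤n , Bₚ.≤-respʳ (Bₚ.·-congʳ n (B.sym (to∘from a))) le
    ⟨⟩-resp′ : ∀ {x} → B.⟨ ⟦ from a ⟧ ⟩ x → B.⟨ a ⟩ x
    ⟨⟩-resp′ (n , 1≤n , le) = n , 1≤n , Bₚ.≤-respʳ (Bₚ.·-congʳ n (to∘from a)) le

module _ (A : MVAlgebra ℓ) where
  open MVAlgebra A

  IsPrincipalMaximalIdeal-resp-≐ : ∀ {I J : Carrier → Set ℓ} → (∀ {x} → I x → J x) → (∀ {x} → J x → I x) →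
    IsPrincipalMaximalIdeal I → IsPrincipalMaximalIdeal J
  IsPrincipalMaximalIdeal-resp-≐ I⊆J J⊆I (I-maximal , a , I⊆⟨a⟩ , ⟨a⟩⊆I) = record
    { isIdeal = record
        { nonempty    = proj₁ nonempty , I⊆J (proj₂ nonempty)
        ; ⊕-closed    = λ p q → I⊆J (⊕-closed (J⊆I p) (J⊆I q))
        ; down-closed = λ x≤y y∈J → I⊆J (down-closed x≤y (J⊆I y∈J))
        }
    ; proper  = λ univ → proper λ x → J⊆I (univ x)
    ; maximal = λ K K-ideal K-proper J⊆K → J⊆K ,
        λ x∈K → I⊆J (proj₂ (maximal K K-ideal K-proper (λ x∈I → J⊆K (I⊆J x∈I))) x∈K)
    } , a , (λ x∈J → I⊆⟨a⟩ (J⊆I x∈J)) , (λ x∈⟨a⟩ → I⊆J (⟨a⟩⊆I x∈⟨a⟩))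
    where
    open IsMaximalIdeal I-maximal
    open IsIdeal isIdeal

-- Valuations and points

-- A homomorphism to the chain 0, ..., `n` under truncated addition, with integer values so that all
-- computations stay in `ℕ`. It may fail to be onto.
record Valuation (A : MVAlgebra ℓ) (n : ℕ) : Set ℓ where
  open MVAlgebra A
  open MVProperties A using (1#; _⊖_; _∨_; ≤-refl)
  field
    val      : Carrier → ℕ
    val-cong : ∀ {x y} → x ≈ y → val x ≡ val y
    val-0    : val 0# ≡ 0
    val-⊕    : ∀ x y → val (x ⊕ y) ≡ n ⊓ (val x + val y)
    val-~    : ∀ x → val (~ x) ≡ n ∸ val x

  val-1 : val 1# ≡ n
  val-1 = ≡.trans (val-~ 0#) (≡.cong (n ∸_) val-0)

  val≤n : ∀ x → val x ≤ℕ n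
  val≤n x = ℕₚ.≤-trans (ℕₚ.≤-reflexive (≡.trans (val-cong (sym (~-involutive x))) (val-~ (~ x))))
    (ℕₚ.m∸n≤m n (val (~ x)))

  val-⊖ : ∀ x y → val (x ⊖ y) ≡ val x ∸ val y
  val-⊖ x y = begin
    val (x ⊖ y)                        ≡⟨ val-~ _ ⟩
    n ∸ val (~ x ⊕ y)                  ≡⟨ ≡.cong (n ∸_) (val-⊕ _ _) ⟩
    n ∸ n ⊓ (val (~ x) + val y)        ≡⟨ ≡.cong (λ k → n ∸ n ⊓ (k + val y)) (val-~ x) ⟩
    n ∸ n ⊓ (n ∸ val x + val y)        ≡⟨ n∸n⊓[n∸a+b]≡a∸b (val y) (val≤n x) ⟩
    val x ∸ val y                      ∎
    where open ≡.≡-Reasoning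

  val-mono-≤ : ∀ {x y} → x ≤ y → val x ≤ℕ val y
  val-mono-≤ {x} {y} x≤y = ℕₚ.m∸n≡0⇒m≤n (≡.trans (≡.sym (val-⊖ x y))
    (≡.trans (val-cong (MVProperties.x≤y⇒x⊖y≈0 A x≤y)) val-0))

  val-· : ∀ m x → val (m · x) ≡ n ⊓ (m * val x)
  val-· zero    x = ≡.trans val-0 (≡.sym (ℕₚ.⊓-zeroʳ n))
  val-· (suc m) x = begin
    val (x ⊕ m · x)                  ≡⟨ val-⊕ _ _ ⟩
    n ⊓ (val x + val (m · x))        ≡⟨ ≡.cong (n ⊓_) (ℕₚ.+-comm (val x) _) ⟩
    n ⊓ (val (m · x) + val x)        ≡⟨ ≡.cong (λ k → n ⊓ (k + val x)) (val-· m x) ⟩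
    n ⊓ (n ⊓ (m * val x) + val x)    ≡⟨ n⊓[n⊓x+y]≡n⊓[x+y] n _ _ ⟩
    n ⊓ (m * val x + val x)          ≡⟨ ≡.cong (n ⊓_) (ℕₚ.+-comm _ (val x)) ⟩
    n ⊓ (suc m * val x)              ∎
    where open ≡.≡-Reasoning

  val-∨-≤ : ∀ {x y k} → val x ≤ℕ k → val y ≤ℕ k → val (x ∨ y) ≤ℕ k
  val-∨-≤ {x} {y} {k} x≤k y≤k = ℕₚ.≤-trans (ℕₚ.≤-reflexive (val-⊕ _ _))
    (ℕₚ.≤-trans (ℕₚ.m⊓n≤n n _) (ℕₚ.≤-trans (ℕₚ.≤-reflexive (≡.cong (_+ val y) (val-⊖ x y)))
    (case (ℕₚ.≤-total (val x) (val y)))))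
    where
    case : val x ≤ℕ val y ⊎ val y ≤ℕ val x → val x ∸ val y + val y ≤ℕ k
    case (inj₁ x≤y) = ℕₚ.≤-trans (ℕₚ.≤-reflexive (≡.cong (_+ val y) (ℕₚ.m≤n⇒m∸n≡0 x≤y))) y≤k
    case (inj₂ y≤x) = ℕₚ.≤-trans (ℕₚ.≤-reflexive (ℕₚ.m∸n+n≡m y≤x)) x≤k

  val-·≡0 : ∀ m {x} → val x ≡ 0 → val (m · x) ≡ 0
  val-·≡0 m x≡0 = ≡.trans (val-· m _) (≡.trans (≡.cong (λ k → n ⊓ (m * k)) x≡0)
    (≡.trans (≡.cong (n ⊓_) (ℕₚ.*-zeroʳ m)) (ℕₚ.⊓-zeroʳ n)))

  kernel : Carrier → Set ℓ
  kernel x = Lift ℓ (val x ≡ 0)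

  ⟨⟩⊆kernel : ∀ {x a} → val a ≡ 0 → ⟨ a ⟩ x → kernel x
  ⟨⟩⊆kernel a≡0 (m , _ , x≤ma) =
    lift (ℕₚ.n≤0⇒n≡0 (ℕₚ.≤-trans (val-mono-≤ x≤ma) (ℕₚ.≤-reflexive (val-·≡0 m a≡0))))

  kernel-isMaximal : .{{NonZero n}} → IsMaximalIdeal kernel
  kernel-isMaximal = record
    { isIdeal = record
        { nonempty    = 0# , lift val-0
        ; ⊕-closed    = λ { (lift p) (lift q) → lift (≡.trans (val-⊕ _ _)
            (≡.trans (≡.cong₂ (λ i j → n ⊓ (i + j)) p q) (ℕₚ.⊓-zeroʳ n))) }
        ; down-closed = λ { x≤y (lift p) → lift (ℕₚ.n≤0⇒n≡0 (ℕₚ.≤-trans (val-mono-≤ x≤y)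
            (ℕₚ.≤-reflexive p))) }
        }
    ; proper  = λ univ → ≢-nonZero⁻¹ n (≡.trans (≡.sym val-1) (lower (univ 1#)))
    ; maximal = λ K K-ideal K-proper kernel⊆K → kernel⊆K , λ {x} x∈K →
        [ lift , (λ x≢0 → contradiction (univ K-ideal kernel⊆K x∈K x≢0) K-proper) ]′ (zero? x)
    }
    where
    zero? : ∀ x → val x ≡ 0 ⊎ 0 < val x
    zero? x with val x
    ... | zero  = inj₁ ≡.refl
    ... | suc _ = inj₂ (s≤s z≤n)

    -- If val x > 0 then val (n · x) = n, so ~ (n · x) lies in the kernel.
    univ : ∀ {K x} → IsIdeal K → (∀ {y} → kernel y → K y) → K x → 0 < val x → ∀ y → K y
    univ {K} {x} K-ideal kernel⊆K x∈K 0<x y =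
      down-closed (MVProperties.x≤1 A y)
        -- `1#` is `~ (n · x) ⊕ n · x`, a sum of two members of `K`.
        (down-closed (≤-reflexive (sym ≤-refl)) (⊕-closed (kernel⊆K (lift ~nx≡0)) (multiple n)))
      where
      open IsIdeal K-ideal
      open MVProperties A using (≤-reflexive)
      multiple : ∀ m → K (m · x)
      multiple zero    = MVProperties.0∈ideal A K-ideal
      multiple (suc m) = ⊕-closed x∈K (multiple m)
      ~nx≡0 : val (~ (n · x)) ≡ 0
      ~nx≡0 = ≡.trans (val-~ _) (ℕₚ.m≤n⇒m∸n≡0 (ℕₚ.≤-trans
        (ℕₚ.≤-reflexive (≡.sym (ℕₚ.m≤n⇒m⊓n≡m (ℕₚ.m≤m*n n (val x) {{>-nonZero 0<x}}))))
        (ℕₚ.≤-reflexive (≡.sym (val-· n x)))))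

pullback : ∀ {A B : MVAlgebra ℓ} {n} → MVHom A B → Valuation B n → Valuation A n
pullback φ v = record
  { val      = λ x → val ⟦ x ⟧
  ; val-cong = λ x≈y → val-cong (⟦⟧-cong x≈y)
  ; val-0    = ≡.trans (val-cong ε-homo) val-0
  ; val-⊕    = λ x y → ≡.trans (val-cong (homo x y)) (val-⊕ _ _)
  ; val-~    = λ x → ≡.trans (val-cong (~-homo x)) (val-~ _)
  }
  where
  open Valuation v
  open MVHom φ

-- Multiplication by `k` commutes with truncation. The new length is tied to `k * n` only by an
-- equation, so that it can be given in another form.
rescale : ∀ {A : MVAlgebra ℓ} {m n} k → Valuation A n → m ≡ k * n → Valuation A m
rescale {m = m} {n} k v m≡kn = record
  { val      = λ x → k * val x
  ; val-cong = λ x≈y → ≡.cong (k *_) (val-cong x≈y)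
  ; val-0    = ≡.trans (≡.cong (k *_) val-0) (ℕₚ.*-zeroʳ k)
  ; val-⊕    = λ x y → begin
      k * val _                      ≡⟨ ≡.cong (k *_) (val-⊕ x y) ⟩
      k * (n ⊓ (val x + val y))      ≡⟨ ℕₚ.*-distribˡ-⊓ k n _ ⟩
      k * n ⊓ (k * (val x + val y))  ≡⟨ ≡.cong₂ _⊓_ (≡.sym m≡kn) (ℕₚ.*-distribˡ-+ k (val x) (val y)) ⟩
      m ⊓ (k * val x + k * val y)    ∎
  ; val-~    = λ x → begin
      k * val _                      ≡⟨ ≡.cong (k *_) (val-~ x) ⟩
      k * (n ∸ val x)                ≡⟨ ℕₚ.*-distribˡ-∸ k n (val x) ⟩
      k * n ∸ k * val x              ≡⟨ ≡.cong (_∸ k * val x) m≡kn ⟨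
      m ∸ k * val x                  ∎
  }
  where
  open Valuation v
  open ≡.≡-Reasoning

-- A surjective homomorphism onto the chain {0, 1/deg, …, 1} with principal
-- kernel, i.e. the quotient map of a principal maximal ideal.
record Point (A : MVAlgebra ℓ) : Set ℓ where
  open MVAlgebra A
  field
    deg         : ℕ
    deg-nonZero : NonZero deg
    valuation   : Valuation A deg
  open Valuation valuation public
  field
    unit      : Carrier
    val-unit  : val unit ≡ 1
    gen       : Carrier
    val-gen   : val gen ≡ 0
    gen-top   : ∀ {x} → val x ≡ 0 → ⟨ gen ⟩ x

  kernel-isPrincipalMaximal : IsPrincipalMaximalIdeal kernel
  kernel-isPrincipalMaximal = kernel-isMaximal {{deg-nonZero}} ,
    gen , (λ x∈ker → gen-top (lower x∈ker)) , ⟨⟩⊆kernel val-gen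

  val-k·unit : ∀ {k} → k ≤ℕ deg → val (k · unit) ≡ k
  val-k·unit {k} k≤deg = ≡.trans (val-· k unit)
    (≡.trans (≡.cong (λ j → deg ⊓ (k * j)) val-unit)
    (≡.trans (≡.cong (deg ⊓_) (ℕₚ.*-identityʳ k)) (ℕₚ.m≥n⇒m⊓n≡n k≤deg)))

module _ {A : MVAlgebra ℓ} where
  open MVAlgebra A

  infix 4 _≈ₚ_ _⊆ₖ_

  _≈ₚ_ : Point A → Point A → Set ℓ
  P ≈ₚ Q = Point.deg P ≡ Point.deg Q × (∀ x → Point.val P x ≡ Point.val Q x)

  _⊆ₖ_ : Point A → Point A → Set ℓ
  P ⊆ₖ Q = ∀ {x} → Point.val P x ≡ 0 → Point.val Q x ≡ 0

  ≈ₚ-isEquivalence : IsEquivalence _≈ₚ_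
  ≈ₚ-isEquivalence = record
    { refl  = ≡.refl , λ _ → ≡.refl
    ; sym   = λ (p , q) → ≡.sym p , λ x → ≡.sym (q x)
    ; trans = λ (p , q) (p′ , q′) → ≡.trans p p′ , λ x → ≡.trans (q x) (q′ x)
    }

  module _ (P Q : Point A) (P⊆Q : P ⊆ₖ Q) where
    private
      module P = Point P
      module Q = Point Q
      c : ℕ
      c = Q.val P.unit

    -- Equal `P`-values put `x ⊖ y` and `y ⊖ x` into the kernel of `P`, hence into that of `Q`.
    val-factors : ∀ {x y} → P.val x ≡ P.val y → Q.val x ≡ Q.val y
    val-factors eq = ℕₚ.≤-antisym (half eq) (half (≡.sym eq))
      where
      half : ∀ {x y} → P.val x ≡ P.val y → Q.val x ≤ℕ Q.val y
      half {x} {y} eq = ℕₚ.m∸n≡0⇒m≤n (≡.trans (≡.sym (Q.val-⊖ x y))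
        (P⊆Q (≡.trans (P.val-⊖ x y) (ℕₚ.m≤n⇒m∸n≡0 (ℕₚ.≤-reflexive eq)))))

    private
      -- `1#` shares its `P`-value with `P.deg · P.unit`, which would have `Q`-value 0 if `c` were
      -- 0.
      0<c : 0 < c
      0<c = ℕₚ.n≢0⇒n>0 λ c≡0 → ≢-nonZero⁻¹ Q.deg {{Q.deg-nonZero}} (≡.trans (≡.sym Q.val-1)
        (≡.trans (val-factors (≡.trans P.val-1 (≡.sym (P.val-k·unit ℕₚ.≤-refl))))
        (Q.val-·≡0 P.deg c≡0)))

      -- The multiple (deg P - 1) · unit and ~ unit have the same P-value, and
      -- since c > 0 there is no truncation in their Q-values.
      deg-scale : Q.deg ≡ P.deg * c
      deg-scale = lemma P.deg P.deg-nonZero ≡.refl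
        where
        lemma : ∀ n → NonZero n → P.deg ≡ n → Q.deg ≡ n * c
        lemma (suc n) _ deg≡ = begin
          Q.deg             ≡⟨ ℕₚ.m∸n+n≡m (Q.val≤n P.unit) ⟨
          Q.deg ∸ c + c     ≡⟨ ≡.cong (_+ c) no-truncation ⟩
          n * c + c         ≡⟨ ℕₚ.+-comm (n * c) c ⟩
          suc n * c         ∎
          where
          open ≡.≡-Reasoning
          truncated : Q.deg ∸ c ≡ Q.deg ⊓ (n * c)
          truncated = begin
            Q.deg ∸ c             ≡⟨ Q.val-~ P.unit ⟨
            Q.val (~ P.unit)      ≡⟨ val-factors (begin
              P.val (~ P.unit)      ≡⟨ P.val-~ P.unit ⟩
              P.deg ∸ P.val P.unit  ≡⟨ ≡.cong₂ _∸_ deg≡ P.val-unit ⟩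
              n                     ≡⟨ P.val-k·unit (ℕₚ.≤-trans (ℕₚ.n≤1+n n) (ℕₚ.≤-reflexive (≡.sym deg≡))) ⟨
              P.val (n · P.unit)    ∎) ⟩
            Q.val (n · P.unit)    ≡⟨ Q.val-· n P.unit ⟩
            Q.deg ⊓ (n * c)       ∎
          no-truncation : Q.deg ∸ c ≡ n * c
          no-truncation with ℕₚ.⊓-sel Q.deg (n * c)
          ... | inj₂ eq = ≡.trans truncated eq
          ... | inj₁ eq = contradiction (≡.trans truncated eq)
            (ℕₚ.<⇒≢ (ℕₚ.∸-monoʳ-< 0<c (Q.val≤n P.unit)))

      -- `x` shares its `P`-value with `P.val x · P.unit`, whose `Q`-value is not truncated, by
      -- `deg-scale`.
      val-scale : ∀ x → Q.val x ≡ P.val x * c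
      val-scale x = begin
        Q.val x                       ≡⟨ val-factors (P.val-k·unit (P.val≤n x)) ⟨
        Q.val (P.val x · P.unit)      ≡⟨ Q.val-· (P.val x) P.unit ⟩
        Q.deg ⊓ (P.val x * c)         ≡⟨ ℕₚ.m≥n⇒m⊓n≡n (≡.subst (P.val x * c ≤ℕ_) (≡.sym deg-scale)
                                            (ℕₚ.*-monoˡ-≤ c (P.val≤n x))) ⟩
        P.val x * c                   ∎
        where open ≡.≡-Reasoning

      -- All values of `Q` are multiples of `c`, and 1 is among them.
      c≡1 : c ≡ 1
      c≡1 = ℕₚ.m*n≡1⇒n≡1 (P.val Q.unit) c (≡.trans (≡.sym (val-scale Q.unit)) Q.val-unit)

    -- One inclusion of kernels suffices: it makes `Q` the `c`-fold of `P`, and surjectivity of `Q`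
    -- forces `c` to be 1.
    ⊆ₖ⇒≈ₚ : P ≈ₚ Q
    ⊆ₖ⇒≈ₚ =
      ≡.sym (≡.trans deg-scale (≡.trans (≡.cong (P.deg *_) c≡1) (ℕₚ.*-identityʳ _))) ,
      λ x → ≡.sym (≡.trans (val-scale x) (≡.trans (≡.cong (P.val x *_) c≡1) (ℕₚ.*-identityʳ _)))

pointSetoid : MVAlgebra ℓ → Setoid ℓ ℓ
pointSetoid A = record { Carrier = Point A ; _≈_ = _≈ₚ_ ; isEquivalence = ≈ₚ-isEquivalence }

module _ {A B : MVAlgebra ℓ} (φ : MVHom A B) (iso : IsIsomorphism φ) where
  open IsomorphismProperties φ iso
  private
    module B = MVAlgebra B
    module Bₚ = MVProperties B

  pullbackPoint : Point B → Point A
  pullbackPoint P = record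
    { deg         = deg
    ; deg-nonZero = deg-nonZero
    ; valuation   = pullback φ valuation
    ; unit        = from unit
    ; val-unit    = ≡.trans (val-cong (to∘from unit)) val-unit
    ; gen         = from gen
    ; val-gen     = ≡.trans (val-cong (to∘from gen)) val-gen
    ; gen-top     = λ x≡0 → let m , 1≤m , le = gen-top x≡0 in
        ⟨⟩-reflects (m , 1≤m , Bₚ.≤-respʳ (Bₚ.·-congʳ m (B.sym (to∘from gen))) le)
    }
    where open Point P

-- Normalising a valuation

module Classical (em : ExcludedMiddle ℓ) where

  least : (P : ℕ → Set ℓ) → ∃ P → ∃ λ k → P k × (∀ j → P j → k ≤ℕ j)
  least P (n , Pn) = [ (λ r → r) , (λ none → n , Pn , λ j Pj → ℕₚ.≮⇒≥ λ j<n → none j j<n Pj) ]′ (search n)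
    where
    search : ∀ n → (∃ λ k → P k × (∀ j → P j → k ≤ℕ j)) ⊎ (∀ j → j < n → ¬ P j)
    search zero = inj₂ λ _ ()
    search (suc n) with search n
    ... | inj₁ found = inj₁ found
    ... | inj₂ none with em {P n}
    ...   | yes Pn = inj₁ (n , Pn , λ j Pj → ℕₚ.≮⇒≥ λ j<n → none j j<n Pj)
    ...   | no ¬Pn = inj₂ λ j j<1+n Pj → [ (λ j<n → none j j<n Pj) , (λ { ≡.refl → ¬Pn Pj }) ]′
                       (ℕₚ.m<1+n⇒m<n∨m≡n j<1+n)

  -- The factorisation through the image: a valuation onto a chain, followed by multiplication by
  -- `scale`.
  record Normalisation {A : MVAlgebra ℓ} {n} (v : Valuation A n) : Set ℓ where
    private module v = Valuation v
    field
      deg         : ℕ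
      deg-nonZero : NonZero deg
      scale       : ℕ
      scale-nonZero : NonZero scale
      valuation   : Valuation A deg
    open Valuation valuation public
    field
      n≡scale*deg : n ≡ scale * deg
      val≡scale*val : ∀ x → v.val x ≡ scale * val x
      unit        : MVAlgebra.Carrier A
      val-unit    : val unit ≡ 1

  -- The values of v are exactly the multiples up to n of the least positive one.
  normalise : ∀ {A : MVAlgebra ℓ} {n} .{{_ : NonZero n}} (v : Valuation A n) → Normalisation v
  normalise {A} {n} v = record
    { deg           = m
    ; deg-nonZero   = ≢-nonZero λ m≡0 → ≢-nonZero⁻¹ n (≡.trans n≡m*c (≡.cong (_* c) m≡0))
    ; scale         = c
    ; scale-nonZero = c-nonZero
    ; valuation     = record
        { val      = w
        ; val-cong = λ x≈y → cancel (≡.trans (≡.sym (v≡w*c _)) (≡.trans (val-cong x≈y) (v≡w*c _)))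
        ; val-0    = cancel (≡.trans (≡.sym (v≡w*c _)) val-0)
        ; val-⊕    = λ x y → cancel (begin
            w (x ⊕ y) * c                ≡⟨ v≡w*c _ ⟨
            val (x ⊕ y)                  ≡⟨ val-⊕ x y ⟩
            n ⊓ (val x + val y)          ≡⟨ ≡.cong₂ _⊓_ n≡m*c (≡.cong₂ _+_ (v≡w*c x) (v≡w*c y)) ⟩
            m * c ⊓ (w x * c + w y * c)  ≡⟨ ≡.cong (m * c ⊓_) (ℕₚ.*-distribʳ-+ c (w x) (w y)) ⟨
            m * c ⊓ ((w x + w y) * c)    ≡⟨ ℕₚ.*-distribʳ-⊓ c m _ ⟨
            (m ⊓ (w x + w y)) * c        ∎)
        ; val-~    = λ x → cancel (begin
            w (~ x) * c                  ≡⟨ v≡w*c _ ⟨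
            val (~ x)                    ≡⟨ val-~ x ⟩
            n ∸ val x                    ≡⟨ ≡.cong₂ _∸_ n≡m*c (v≡w*c x) ⟩
            m * c ∸ w x * c              ≡⟨ ℕₚ.*-distribʳ-∸ c m (w x) ⟨
            (m ∸ w x) * c                ∎)
        }
    ; n≡scale*deg   = ≡.trans n≡m*c (ℕₚ.*-comm m c)
    ; val≡scale*val = λ x → ≡.trans (v≡w*c x) (ℕₚ.*-comm (w x) c)
    ; unit          = a
    ; val-unit      = cancel (≡.trans (≡.sym (v≡w*c a)) (≡.trans va≡c (≡.sym (ℕₚ.+-identityʳ c))))
    }
    where
    open MVAlgebra A
    open MVProperties A using (1#; _⊖_)
    open Valuation v
    open ≡.≡-Reasoning
    IsPositiveValue : ℕ → Set ℓ
    IsPositiveValue k = NonZero k × ∃ λ a → val a ≡ k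
    smallest : ∃ λ c → IsPositiveValue c × (∀ j → IsPositiveValue j → c ≤ℕ j)
    smallest = least IsPositiveValue (n , ≢-nonZero (≢-nonZero⁻¹ n) , 1# , val-1)
    c : ℕ
    c = proj₁ smallest
    c-nonZero : NonZero c
    c-nonZero = proj₁ (proj₁ (proj₂ smallest))
    a : Carrier
    a = proj₁ (proj₂ (proj₁ (proj₂ smallest)))
    va≡c : val a ≡ c
    va≡c = proj₂ (proj₂ (proj₁ (proj₂ smallest)))
    instance
      _ : NonZero c
      _ = c-nonZero
    -- Descent: subtracting `a` lowers a positive value by exactly `c`, since by minimality no
    -- positive value is smaller than `c`.
    c∣-below : ∀ k x → val x ≡ k → Acc _<_ k → c ∣ k
    c∣-below zero    x vx≡k _         = c ∣0
    c∣-below (suc k) x vx≡k (acc rec) = ≡.subst (c ∣_) (ℕₚ.m∸n+n≡m c≤k)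
      (∣m∣n⇒∣m+n (c∣-below (suc k ∸ c) (x ⊖ a) (≡.trans (val-⊖ x a) (≡.cong₂ _∸_ vx≡k va≡c))
        (rec (ℕₚ.∸-monoʳ-< (>-nonZero⁻¹ c) c≤k))) ∣-refl)
      where
      c≤k : c ≤ℕ suc k
      c≤k = proj₂ (proj₂ smallest) (suc k) (_ , x , vx≡k)
    c∣v : ∀ x → c ∣ val x
    c∣v x = c∣-below (val x) x ≡.refl (<-wellFounded _)
    w : Carrier → ℕ
    w x = _∣_.quotient (c∣v x)
    v≡w*c : ∀ x → val x ≡ w x * c
    v≡w*c x = _∣_.equality (c∣v x)
    m : ℕ
    m = w 1#
    n≡m*c : n ≡ m * c
    n≡m*c = ≡.trans (≡.sym val-1) (v≡w*c 1#)
    cancel : ∀ {i j} → i * c ≡ j * c → i ≡ j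
    cancel = ℕₚ.*-cancelʳ-≡ _ _ c

-- Products of chains

-- The product over x ∈ X of the chains {0, 1/σ(x), …, 1}, with each chain
-- rescaled to {0, …, σ(x)}.
Product : Multiset ℓ → MVAlgebra ℓ
Product {ℓ} M = record
  { Carrier             = Carrier
  ; _≈_                 = _≈_
  ; _⊕_                 = λ (a , a≤σ , a-cong) (b , b≤σ , b-cong) →
      (λ x → σ x ⊓ (a x + b x)) , (λ x → ℕₚ.m⊓n≤m (σ x) _) ,
      λ x≈y → ≡.cong₂ _⊓_ (σ-cong x≈y) (≡.cong₂ _+_ (a-cong x≈y) (b-cong x≈y))
  ; 0#                  = (λ _ → 0) , (λ _ → z≤n) , λ _ → ≡.refl
  ; ~_                  = λ (a , a≤σ , a-cong) →
      (λ x → σ x ∸ a x) , (λ x → ℕₚ.m∸n≤m (σ x) (a x)) ,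
      λ x≈y → ≡.cong₂ _∸_ (σ-cong x≈y) (a-cong x≈y)
  ; isCommutativeMonoid = record
      { isMonoid = record
          { isSemigroup = record
              { isMagma = record
                  { isEquivalence = record
                      { refl  = λ x → ≡.refl
                      ; sym   = λ p x → ≡.sym (p x)
                      ; trans = λ p q x → ≡.trans (p x) (q x)
                      }
                  ; ∙-cong = λ p q x → ≡.cong₂ (λ i j → σ x ⊓ (i + j)) (p x) (q x)
                  }
              ; assoc = λ (a , _) (b , _) (c , _) x → assoc (σ x) (a x) (b x) (c x)
              }
          ; identity = (λ (_ , a≤σ , _) x → ℕₚ.m≥n⇒m⊓n≡n (a≤σ x)) ,
                       (λ (a , a≤σ , _) x → ≡.trans (≡.cong (σ x ⊓_) (ℕₚ.+-identityʳ (a x)))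
                          (ℕₚ.m≥n⇒m⊓n≡n (a≤σ x)))
          }
      ; comm = λ (a , _) (b , _) x → ≡.cong (σ x ⊓_) (ℕₚ.+-comm (a x) (b x))
      }
  ; ~-cong              = λ p x → ≡.cong (σ x ∸_) (p x)
  ; ~-involutive        = λ (_ , a≤σ , _) x → ℕₚ.m∸[m∸n]≡n (a≤σ x)
  ; ~0-zeroˡ            = λ (a , _) x → ℕₚ.m≤n⇒m⊓n≡m (ℕₚ.m≤m+n (σ x) (a x))
  ; ~⊕-exchange         = λ (a , a≤σ , _) (b , b≤σ , _) x → ≡.cong (σ x ⊓_) (begin
      σ x ∸ σ x ⊓ (σ x ∸ a x + b x) + b x  ≡⟨ ≡.cong (_+ b x) (n∸n⊓[n∸a+b]≡a∸b (b x) (a≤σ x)) ⟩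
      a x ∸ b x + b x                      ≡⟨ m∸n+n≡n∸m+m (a x) (b x) ⟩
      b x ∸ a x + a x                      ≡⟨ ≡.cong (_+ a x) (n∸n⊓[n∸a+b]≡a∸b (a x) (b≤σ x)) ⟨
      σ x ∸ σ x ⊓ (σ x ∸ b x + a x) + a x  ∎)
  }
  where
  open Multiset M using (X)
  open Func (Multiset.σ M) using () renaming (to to σ; cong to σ-cong)
  open ≡.≡-Reasoning
  Carrier : Set ℓ
  Carrier = Σ (Setoid.Carrier X → ℕ) λ a →
    (∀ x → a x ≤ℕ σ x) × (∀ {x y} → Setoid._≈_ X x y → a x ≡ a y)
  _≈_ : Rel Carrier ℓ
  (a , _) ≈ (b , _) = ∀ x → a x ≡ b x
  assoc : ∀ n i j k → n ⊓ (n ⊓ (i + j) + k) ≡ n ⊓ (i + n ⊓ (j + k))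
  assoc n i j k = begin
    n ⊓ (n ⊓ (i + j) + k)     ≡⟨ n⊓[n⊓x+y]≡n⊓[x+y] n (i + j) k ⟩
    n ⊓ (i + j + k)           ≡⟨ ≡.cong (n ⊓_) (ℕₚ.+-assoc i j k) ⟩
    n ⊓ (i + (j + k))         ≡⟨ ≡.cong (n ⊓_) (ℕₚ.+-comm i (j + k)) ⟩
    n ⊓ (j + k + i)           ≡⟨ n⊓[n⊓x+y]≡n⊓[x+y] n (j + k) i ⟨
    n ⊓ (n ⊓ (j + k) + i)     ≡⟨ ≡.cong (n ⊓_) (ℕₚ.+-comm _ i) ⟩
    n ⊓ (i + n ⊓ (j + k))     ∎

module _ {A : MVAlgebra ℓ} (M : Multiset ℓ) where
  open Multiset M using (X)
  open Func (Multiset.σ M) using () renaming (to to σ)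

  tuple : (v : ∀ x → Valuation A (σ x)) →
    (∀ {x y} → Setoid._≈_ X x y → ∀ a → Valuation.val (v x) a ≡ Valuation.val (v y) a) →
    MVHom A (Product M)
  tuple v v-cong = record
    { ⟦_⟧                  = λ a → (λ x → Valuation.val (v x) a) , (λ x → Valuation.val≤n (v x) a) ,
        λ x≈y → v-cong x≈y a
    ; isMonoidHomomorphism = record
        { isMagmaHomomorphism = record
            { isRelHomomorphism = record { cong = λ {a} {b} a≈b x → Valuation.val-cong (v x) {a} {b} a≈b }
            ; homo              = λ a b x → Valuation.val-⊕ (v x) a b
            }
        ; ε-homo = λ x → Valuation.val-0 (v x)
        }
    ; ~-homo               = λ a x → Valuation.val-~ (v x) a
    }

Spec : MVAlgebra ℓ → Multiset ℓ
Spec A = record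
  { X         = pointSetoid A
  ; σ         = record { to = Point.deg ; cong = proj₁ }
  ; σ-nonZero = Point.deg-nonZero
  }

evaluate : (A : MVAlgebra ℓ) → MVHom A (Product (Spec A))
evaluate A = tuple (Spec A) Point.valuation proj₂

-- Integer square roots

floor-sqrt : ∀ n → ∃ λ t → t * t ≤ℕ n × n < suc t * suc t
floor-sqrt zero = 0 , z≤n , s≤s z≤n
floor-sqrt (suc n) with floor-sqrt n
... | t , t²≤n , n<[1+t]² with ℕₚ.m≤n⇒m<n∨m≡n n<[1+t]²
...   | inj₁ lt = t , ℕₚ.m≤n⇒m≤1+n t²≤n , lt
...   | inj₂ eq = suc t , ℕₚ.≤-reflexive (≡.sym eq) , ℕₚ.<-≤-trans
        (≡.subst (_< suc t * suc (suc t)) (≡.sym eq) (ℕₚ.*-monoʳ-< (suc t) (ℕₚ.n<1+n (suc t))))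
        (ℕₚ.*-monoˡ-≤ (suc (suc t)) (ℕₚ.n≤1+n (suc t)))

⌊√_⌋ : ℕ → ℕ
⌊√ n ⌋ = proj₁ (floor-sqrt n)

square-cancel-≤ : ∀ {m n} → m * m < suc n * suc n → m ≤ℕ n
square-cancel-≤ {m} {n} lt = ℕₚ.≮⇒≥ λ n<m → ℕₚ.<⇒≱ lt (ℕₚ.*-mono-≤ n<m n<m)

m²≤n⇒m≤⌊√n⌋ : ∀ {m n} → m * m ≤ℕ n → m ≤ℕ ⌊√ n ⌋
m²≤n⇒m≤⌊√n⌋ {m} {n} le = square-cancel-≤ (ℕₚ.≤-<-trans le (proj₂ (proj₂ (floor-sqrt n))))

n≤m²⇒⌊√n⌋≤m : ∀ {m n} → n ≤ℕ m * m → ⌊√ n ⌋ ≤ℕ m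
n≤m²⇒⌊√n⌋≤m {m} {n} le = square-cancel-≤ (ℕₚ.≤-<-trans (ℕₚ.≤-trans (proj₁ (proj₂ (floor-sqrt n))) le)
  (ℕₚ.*-mono-< (ℕₚ.n<1+n m) (ℕₚ.n<1+n m)))

-- Principal maximal ideals and points of a product of chains

module ProductProperties (M : Multiset ℓ) where
  open Multiset M using (X; σ-nonZero) public
  open Func (Multiset.σ M) public using () renaming (to to σ; cong to σ-cong)
  open MVAlgebra (Product M) public
  open MVProperties (Product M) public
  open Setoid X public using ()
    renaming (Carrier to ∣X∣; _≈_ to _≈ₓ_; refl to ≈ₓ-refl; sym to ≈ₓ-sym; trans to ≈ₓ-trans)

  infix 9 _at_
  _at_ : Carrier → ∣X∣ → ℕ
  (a , _) at x = a x

  at≤σ : ∀ a x → a at x ≤ℕ σ x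
  at≤σ (_ , a≤σ , _) = a≤σ

  at-cong : ∀ a {x y} → x ≈ₓ y → a at x ≡ a at y
  at-cong (_ , _ , a-cong) = a-cong

  evaluation : ∀ x → Valuation (Product M) (σ x)
  evaluation x = record
    { val      = _at x
    ; val-cong = λ a≈b → a≈b x
    ; val-0    = ≡.refl
    ; val-⊕    = λ _ _ → ≡.refl
    ; val-~    = λ _ → ≡.refl
    }

  ≤⇒at≤ : ∀ a b → a ≤ b → ∀ x → a at x ≤ℕ b at x
  ≤⇒at≤ a b a≤b x = Valuation.val-mono-≤ (evaluation x) {a} {b} a≤b

  at≤⇒≤ : ∀ a b → (∀ x → a at x ≤ℕ b at x) → a ≤ b
  at≤⇒≤ a b a≤b = x⊖y≈0⇒x≤y {a} {b} λ x →
    ≡.trans (Valuation.val-⊖ (evaluation x) a b) (ℕₚ.m≤n⇒m∸n≡0 (a≤b x))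

  ≤·⇒at≤* : ∀ a b m → a ≤ m · b → ∀ x → a at x ≤ℕ m * b at x
  ≤·⇒at≤* a b m a≤mb x = ℕₚ.≤-trans (≤⇒at≤ a (m · b) a≤mb x)
    (ℕₚ.≤-trans (ℕₚ.≤-reflexive (Valuation.val-· (evaluation x) m b)) (ℕₚ.m⊓n≤n (σ x) _))

  at≤*⇒≤· : ∀ a b m → (∀ x → a at x ≤ℕ m * b at x) → a ≤ m · b
  at≤*⇒≤· a b m a≤mb = at≤⇒≤ a (m · b) λ x → ℕₚ.≤-trans (ℕₚ.⊓-glb (at≤σ a x) (a≤mb x))
    (ℕₚ.≤-reflexive (≡.sym (Valuation.val-· (evaluation x) m b)))


  module _ (em : ExcludedMiddle ℓ) where

    -- Excluded middle decides `P` at each coordinate; invariance of `P` under `≈ₓ` makes the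
    -- cut-off function an element of the product.
    indicator : (P : ∣X∣ → Set ℓ) → (∀ {x y} → x ≈ₓ y → P x → P y) → (f : Carrier) →
      ∃ λ g → (∀ x → P x → g at x ≡ 0) × (∀ x → ¬ P x → g at x ≡ f at x)
    indicator P resp f = (g , g≤σ , g-cong) , off , on
      where
      g : ∣X∣ → ℕ
      g x with em {P x}
      ... | yes _ = 0
      ... | no  _ = f at x
      off : ∀ x → P x → g x ≡ 0
      off x Px with em {P x}
      ... | yes _  = ≡.refl
      ... | no ¬Px = contradiction Px ¬Px
      on : ∀ x → ¬ P x → g x ≡ f at x
      on x ¬Px with em {P x}
      ... | yes Px = contradiction Px ¬Px
      ... | no  _  = ≡.refl
      g≤σ : ∀ x → g x ≤ℕ σ x
      g≤σ x with em {P x}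
      ... | yes _ = z≤n
      ... | no  _ = at≤σ f x
      g-cong : ∀ {x y} → x ≈ₓ y → g x ≡ g y
      g-cong {x} {y} x≈y with em {P x} | em {P y}
      ... | yes _  | yes _  = ≡.refl
      ... | no _   | no _   = at-cong f x≈y
      ... | yes Px | no ¬Py = contradiction (resp x≈y Px) ¬Py
      ... | no ¬Px | yes Py = contradiction (resp (≈ₓ-sym x≈y) Py) ¬Px

    private
      -- This is the largest element of the kernel of evaluation at `x`, hence a generator of it.
      vanishingAt : ∀ x → ∃ λ g → (∀ y → x ≈ₓ y → g at y ≡ 0) × (∀ y → ¬ x ≈ₓ y → g at y ≡ σ y)
      vanishingAt x = indicator (x ≈ₓ_) (λ y≈z x≈y → ≈ₓ-trans x≈y y≈z) 1#

    evaluationPoint : ∣X∣ → Point (Product M)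
    evaluationPoint x = record
      { deg         = σ x
      ; deg-nonZero = σ-nonZero x
      ; valuation   = evaluation x
      ; unit        = one
      ; val-unit    = ≡.refl
      ; gen         = proj₁ (vanishingAt x)
      ; val-gen     = proj₁ (proj₂ (vanishingAt x)) x ≈ₓ-refl
      ; gen-top     = λ {a} ax≡0 → ⟨⟩-containing {a} (at≤⇒≤ a (proj₁ (vanishingAt x)) λ y → below a ax≡0 y)
      }
      where
      one : Carrier
      -- The constant 1 is admissible because multiplicities are positive.
      one = (λ _ → 1) , (λ y → >-nonZero⁻¹ (σ y) {{σ-nonZero y}}) , λ _ → ≡.refl
      below : ∀ a → a at x ≡ 0 → ∀ y → a at y ≤ℕ proj₁ (vanishingAt x) at y
      below a ax≡0 y = case em of λ where
        (yes x≈y) → ℕₚ.≤-trans (ℕₚ.≤-reflexive (≡.trans (≡.sym (at-cong a x≈y)) ax≡0)) z≤n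
        (no x≉y)  → ℕₚ.≤-trans (at≤σ a y) (ℕₚ.≤-reflexive (≡.sym (proj₂ (proj₂ (vanishingAt x)) y x≉y)))

    evaluationPoint-cong : ∀ {x y} → x ≈ₓ y → evaluationPoint x ≈ₚ evaluationPoint y
    evaluationPoint-cong x≈y = σ-cong x≈y , λ a → at-cong a x≈y

    -- The element vanishing exactly at `x` tells `x` apart from every other coordinate.
    evaluationPoint-injective : ∀ {x y} → evaluationPoint x ≈ₚ evaluationPoint y → x ≈ₓ y
    evaluationPoint-injective {x} {y} (_ , eq) = decidable-stable em λ x≉y →
      ≢-nonZero⁻¹ (σ y) {{σ-nonZero y}}
        (≡.trans (≡.sym (off y x≉y)) (≡.trans (≡.sym (eq g)) (on x ≈ₓ-refl)))
      where
      g = proj₁ (vanishingAt x)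
      on = proj₁ (proj₂ (vanishingAt x))
      off = proj₂ (proj₂ (vanishingAt x))

    -- A generator a of J vanishes somewhere: otherwise the pointwise geometric
    -- mean b of a and 1 generates a proper ideal strictly above J.
    module _ {J : Carrier → Set ℓ} (J-pm : IsPrincipalMaximalIdeal J) where
      private
        open IsMaximalIdeal (proj₁ J-pm)
        open IsIdeal isIdeal
        a : Carrier
        a = proj₁ (proj₂ J-pm)
        J⊆⟨a⟩ : ∀ {b} → J b → ⟨ a ⟩ b
        J⊆⟨a⟩ = proj₁ (proj₂ (proj₂ J-pm))
        ⟨a⟩⊆J : ∀ {b} → ⟨ a ⟩ b → J b
        ⟨a⟩⊆J = proj₂ (proj₂ (proj₂ J-pm))

        -- Otherwise every element lies below a multiple of `a`. Passing from `m` to `suc m` makes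
        -- the multiple positive, as `⟨_⟩` demands.
        a-unbounded : ∀ m → ¬ (∀ x → σ x ≤ℕ m * a at x)
        a-unbounded m σ≤ma = proper λ b → ⟨a⟩⊆J (suc m , s≤s z≤n ,
          at≤*⇒≤· b a (suc m) λ x → ℕₚ.≤-trans (at≤σ b x)
            (ℕₚ.≤-trans (σ≤ma x) (ℕₚ.m≤n+m (m * a at x) (a at x))))

        -- After division of all values by `σ x` this is the square root of `a`, up to rounding
        -- down.
        b : Carrier
        b = (λ x → ⌊√ a at x * σ x ⌋) ,
          (λ x → n≤m²⇒⌊√n⌋≤m (ℕₚ.*-monoˡ-≤ (σ x) (at≤σ a x))) ,
          λ x≈y → ≡.cong ⌊√_⌋ (≡.cong₂ _*_ (at-cong a x≈y) (σ-cong x≈y))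

        -- The ideal generated by `b`. The bound is left untruncated, which is harmless because
        -- `c at x` never exceeds `σ x`.
        K : Carrier → Set ℓ
        K c = ∃ λ m → ∀ x → c at x ≤ℕ m * b at x

        K-isIdeal : IsIdeal K
        K-isIdeal = record
          { nonempty    = 0# , 0 , λ _ → z≤n
          ; ⊕-closed    = λ { (m , c≤) (n , d≤) → m + n , λ x → ℕₚ.≤-trans (ℕₚ.m⊓n≤n (σ x) _)
              (ℕₚ.≤-trans (ℕₚ.+-mono-≤ (c≤ x) (d≤ x))
                (ℕₚ.≤-reflexive (≡.sym (ℕₚ.*-distribʳ-+ (b at x) m n)))) }
          ; down-closed = λ {c} {d} c≤d (m , d≤) → m , λ x → ℕₚ.≤-trans (≤⇒at≤ c d c≤d x) (d≤ x)
          }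

        -- From σ ≤ m b follows σ² ≤ m² b² ≤ m² a σ, so σ ≤ m² a at every coordinate.
        K-proper : ¬ (∀ c → K c)
        K-proper univ with univ 1#
        ... | m , σ≤mb = a-unbounded (m * m) λ x → ℕₚ.*-cancelʳ-≤ _ _ (σ x) {{σ-nonZero x}} (begin
            σ x * σ x                            ≤⟨ ℕₚ.*-mono-≤ (σ≤mb x) (σ≤mb x) ⟩
            (m * b at x) * (m * b at x)          ≡⟨ ℕₚ.[m*n]*[o*p]≡[m*o]*[n*p] m (b at x) m (b at x) ⟩
            (m * m) * (b at x * b at x)          ≤⟨ ℕₚ.*-monoʳ-≤ (m * m) (proj₁ (proj₂ (floor-sqrt (a at x * σ x)))) ⟩
            (m * m) * (a at x * σ x)             ≡⟨ ℕₚ.*-assoc (m * m) _ _ ⟨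
            m * m * a at x * σ x                 ∎)
          where
          open ℕₚ.≤-Reasoning

        -- `a` lies below `b` because a² ≤ a σ at every coordinate.
        J⊆K : ∀ {c} → J c → K c
        J⊆K {c} c∈J with J⊆⟨a⟩ c∈J
        ... | m , _ , c≤ma = m , λ x → ℕₚ.≤-trans (≤·⇒at≤* c a m c≤ma x)
          (ℕₚ.*-monoʳ-≤ m (m²≤n⇒m≤⌊√n⌋ (ℕₚ.*-monoʳ-≤ (a at x) (at≤σ a x))))

        -- From b ≤ m a follows a σ < (b + 1)² ≤ ((m + 1) a)²: the rounding error 1 is absorbed by a
        -- ≥ 1. Cancelling one factor a bounds σ by (m + 1)² a.
        b∉J : (∀ x → NonZero (a at x)) → ¬ J b
        b∉J a≢0 b∈J with J⊆⟨a⟩ b∈J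
        ... | m , _ , b≤ma = a-unbounded (suc m * suc m) λ x →
          ℕₚ.*-cancelˡ-≤ (a at x) {{a≢0 x}} (begin
            a at x * σ x                                 <⟨ proj₂ (proj₂ (floor-sqrt (a at x * σ x))) ⟩
            suc (b at x) * suc (b at x)                  ≤⟨ ℕₚ.*-mono-≤ (bound x) (bound x) ⟩
            (suc m * a at x) * (suc m * a at x)          ≡⟨ solve 2 (λ m a → (m :* a) :* (m :* a) :=
                                                              a :* (m :* m :* a)) ≡.refl (suc m) (a at x) ⟩
            a at x * (suc m * suc m * a at x)            ∎)
          where
          open ℕₚ.≤-Reasoning using (begin_; step-<; step-≤; step-≡-⟩; _∎)
          open +-*-Solver
          bound : ∀ x → suc (b at x) ≤ℕ suc m * a at x
          bound x = ℕₚ.+-mono-≤ (>-nonZero⁻¹ (a at x) {{a≢0 x}}) (≤·⇒at≤* b a m b≤ma x)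

        zero-of-a : ∃ λ x → a at x ≡ 0
        zero-of-a with em {∃ λ x → a at x ≡ 0}
        ... | yes z = z
        -- The multiplier 1 puts `b` into `K`, and maximality would then put it into `J`.
        ... | no ¬z = contradiction (proj₂ (maximal K K-isIdeal K-proper J⊆K) (1 , λ x → ℕₚ.m≤m+n _ 0))
                (b∉J λ x → ≢-nonZero λ ax≡0 → ¬z (x , ax≡0))

      -- At a zero of the generator all of `J` vanishes; maximality of `J` turns this inclusion into
      -- an equality.
      principalMaximal⇒evaluation : ∃ λ x → (∀ {c} → J c → c at x ≡ 0) × (∀ {c} → c at x ≡ 0 → J c)
      principalMaximal⇒evaluation with zero-of-a
      ... | x , ax≡0 = x , J⊆kernel , λ cx≡0 → proj₂ (maximal P.kernel kernel.isIdeal kernel.proper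
              (λ c∈J → lift (J⊆kernel c∈J))) (lift cx≡0)
        where
        module P = Point (evaluationPoint x)
        module kernel = IsMaximalIdeal (proj₁ (P.kernel-isPrincipalMaximal))
        J⊆kernel : ∀ {c} → J c → c at x ≡ 0
        J⊆kernel {c} c∈J = lower (P.⟨⟩⊆kernel {c} {a} ax≡0 (J⊆⟨a⟩ c∈J))

    point≈evaluation : (P : Point (Product M)) → ∃ λ x → P ≈ₚ evaluationPoint x
    point≈evaluation P = x , ⊆ₖ⇒≈ₚ P (evaluationPoint x) (λ v≡0 → P⊆ (lift v≡0))
      where
      evaluation∈ = principalMaximal⇒evaluation (Point.kernel-isPrincipalMaximal P)
      x = proj₁ evaluation∈
      P⊆ = proj₁ (proj₂ evaluation∈)

    location : Point (Product M) → ∣X∣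
    location P = proj₁ (point≈evaluation P)

    P≈evaluation-location : ∀ P → P ≈ₚ evaluationPoint (location P)
    P≈evaluation-location P = proj₂ (point≈evaluation P)

    location-cong : ∀ P Q → P ≈ₚ Q → location P ≈ₓ location Q
    location-cong P Q P≈Q = evaluationPoint-injective
      (≈ₚ.trans {evaluationPoint (location P)} {P} {evaluationPoint (location Q)}
        (≈ₚ.sym {P} {evaluationPoint (location P)} (P≈evaluation-location P))
        (≈ₚ.trans {P} {Q} {evaluationPoint (location Q)} P≈Q (P≈evaluation-location Q)))
      where module ≈ₚ = Setoid (pointSetoid (Product M))

    location-evaluationPoint : ∀ x → location (evaluationPoint x) ≈ₓ x
    location-evaluationPoint x = ≈ₓ-sym (evaluationPoint-injective (P≈evaluation-location (evaluationPoint x)))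

-- Profiniteness of products of chains

module _ (em : ExcludedMiddle ℓ) (S : Setoid ℓ ℓ) where
  open Setoid S

  -- The code may miss some values; excluded middle decides which ones occur, and these are
  -- enumerated in order.
  finite-by-coding : ∀ {m} (code : Carrier → Fin m) → (∀ {x y} → x ≈ y → code x ≡ code y) →
    (∀ {x y} → code x ≡ code y → x ≈ y) → ∃ λ n → Inverse (≡.setoid (Fin n)) S
  finite-by-coding {m} code code-cong code-injective with enumerate m
    where
    enumerate : ∀ k → Σ ℕ λ n → Σ (Fin n → Carrier) λ e →
      (∀ {i j} → e i ≈ e j → i ≡ j) × (∀ i → toℕ (code (e i)) < k) ×
      (∀ x → toℕ (code x) < k → ∃ λ i → e i ≈ x)
    enumerate zero = 0 , (λ ()) , (λ { {()} }) , (λ ()) , λ _ ()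
    enumerate (suc k) with enumerate k | em {∃ λ x → toℕ (code x) ≡ k}
    ... | n , e , e-injective , e<k , e-onto | no ¬hit = n , e , e-injective ,
      (λ i → ℕₚ.m≤n⇒m≤1+n (e<k i)) ,
      λ x x<1+k → e-onto x (ℕₚ.≤∧≢⇒< (ℕₚ.≤-pred x<1+k) λ eq → ¬hit (x , eq))
    ... | n , e , e-injective , e<k , e-onto | yes (x₀ , x₀↦k) =
      suc n , e′ , (λ {i} {j} → injective i j) , bound , onto
      where
      e′ : Fin (suc n) → Carrier
      e′ zero    = x₀
      e′ (suc i) = e i
      bound : ∀ i → toℕ (code (e′ i)) < suc k
      bound zero    = s≤s (ℕₚ.≤-reflexive x₀↦k)
      bound (suc i) = ℕₚ.m≤n⇒m≤1+n (e<k i)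
      fresh : ∀ i → ¬ x₀ ≈ e i
      fresh i eq = ℕₚ.<⇒≢ (e<k i) (≡.trans (≡.cong toℕ (code-cong (sym eq))) x₀↦k)
      injective : ∀ i j → e′ i ≈ e′ j → i ≡ j
      injective zero    zero    _  = ≡.refl
      injective zero    (suc j) eq = contradiction eq (fresh j)
      injective (suc i) zero    eq = contradiction (sym eq) (fresh i)
      injective (suc i) (suc j) eq = ≡.cong suc (e-injective eq)
      onto : ∀ x → toℕ (code x) < suc k → ∃ λ i → e′ i ≈ x
      onto x x<1+k with ℕₚ.m<1+n⇒m<n∨m≡n x<1+k
      ... | inj₁ x<k = let i , eq = e-onto x x<k in suc i , eq
      ... | inj₂ x≡k = zero , code-injective (Finₚ.toℕ-injective (≡.trans x₀↦k (≡.sym x≡k)))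
  ... | n , e , e-injective , _ , e-onto = n , record
    { to        = e
    ; from      = index
    ; to-cong   = λ { ≡.refl → refl }
    ; from-cong = λ {x} {y} x≈y → e-injective (trans (e∘index x) (trans x≈y (sym (e∘index y))))
    ; inverse   = (λ { ≡.refl → e∘index _ }) , (λ x≈ei → e-injective (trans (e∘index _) x≈ei))
    }
    where
    index : Carrier → Fin n
    index x = proj₁ (e-onto x (Finₚ.toℕ<n (code x)))
    e∘index : ∀ x → e (index x) ≈ x
    e∘index x = proj₂ (e-onto x (Finₚ.toℕ<n (code x)))

module _ (em : ExcludedMiddle ℓ) (M : Multiset ℓ) where
  open ProductProperties M

  private
    Agree : List ∣X∣ → Carrier → Carrier → Set ℓ
    Agree l a b = All (λ x → a at x ≡ b at x) l

    Agree-isEquivalence : ∀ l → IsEquivalence (Agree l)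
    Agree-isEquivalence l = record
      { refl  = All.universal (λ _ → ≡.refl) l
      ; sym   = All.map ≡.sym
      ; trans = λ p q → All.zipWith (λ (eq , eq′) → ≡.trans eq eq′) (p , q)
      }

    -- The finite product over l, as a quotient of the whole product.
    Restriction : List ∣X∣ → MVAlgebra ℓ
    Restriction l = coarsen (Agree l) (Agree-isEquivalence l)
      (λ a≈b → All.universal a≈b l)
      (λ p q → All.zipWith (λ {x} (eq , eq′) → ≡.cong₂ (λ i j → σ x ⊓ (i + j)) eq eq′) (p , q))
      (All.map (λ {x} → ≡.cong (σ x ∸_)))

    size : List ∣X∣ → ℕ
    size []      = 1
    size (x ∷ l) = suc (σ x) * size l

    coordinate : Carrier → ∀ x → Fin (suc (σ x))
    coordinate a x = fromℕ< (s≤s (at≤σ a x))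

    code : ∀ l → Carrier → Fin (size l)
    code []      a = zero
    code (x ∷ l) a = combine (coordinate a x) (code l a)

    code-cong : ∀ l {a b} → Agree l a b → code l a ≡ code l b
    code-cong []      []       = ≡.refl
    code-cong (x ∷ l) (p ∷ ps) = ≡.cong₂ combine (Finₚ.fromℕ<-cong _ _ p _ _) (code-cong l ps)

    code-injective : ∀ l {a b} → code l a ≡ code l b → Agree l a b
    code-injective []      _  = []
    code-injective (x ∷ l) {a} {b} eq =
      let eq₁ , eq₂ = Finₚ.combine-injective (coordinate a x) (code l a) (coordinate b x) (code l b) eq
      in Finₚ.fromℕ<-injective _ _ _ _ eq₁ ∷ code-injective l eq₂

    -- Phrased through agreement instead of membership, so that antisymmetry is immediate and lists
    -- with `≈ₓ`-equal entries are comparable.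
    _≼_ : Rel (List ∣X∣) ℓ
    l ≼ m = ∀ a b → Agree m a b → Agree l a b

    restrictions : FiniteInverseSystem ℓ
    restrictions = record
      { index    = record
          { Carrier        = List ∣X∣
          ; _≈_            = λ l m → l ≼ m × m ≼ l
          ; _≤_            = _≼_
          ; isPartialOrder = record
              { isPreorder = record
                  { isEquivalence = record
                      { refl  = (λ _ _ p → p) , (λ _ _ p → p)
                      ; sym   = λ (p , q) → q , p
                      ; trans = λ (p , q) (p′ , q′) → (λ a b r → p a b (p′ a b r)) , (λ a b r → q′ a b (q a b r))
                      }
                  ; reflexive     = λ p → proj₁ p
                  ; trans         = λ p q a b r → p a b (q a b r)
                  }
              ; antisym    = λ p q → p , q
              }
          }
      ; directed = record
          { inhabitant = []
          ; upperBound = λ l m → l ++ m , (λ _ _ → Allₚ.++⁻ˡ l) , (λ _ _ → Allₚ.++⁻ʳ l)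
          }
      ; alg      = Restriction
      ; finite   = λ l → finite-by-coding em (MVAlgebra.setoid (Restriction l))
          (code l) (code-cong l) (code-injective l)
      ; map      = λ {l} {m} l≼m → let module R = MVAlgebra (Restriction l) in record
          { ⟦_⟧                  = λ a → a
          ; isMonoidHomomorphism = record
              { isMagmaHomomorphism = record
                  { isRelHomomorphism = record { cong = λ {a} {b} → l≼m a b }
                  ; homo              = λ a b → R.refl {a ⊕ b}
                  }
              ; ε-homo = R.refl {0#}
              }
          ; ~-homo               = λ a → R.refl {~ a}
          }
      ; map-id   = λ {l} _ a → MVAlgebra.refl (Restriction l) {a}
      ; map-∘    = λ {l} _ _ _ a → MVAlgebra.refl (Restriction l) {a}
      }

  -- A compatible family determines an element: its value at `x` is read off the component at the
  -- singleton list of `x`.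
  Product-isProfinite : IsProfinite (Product M)
  Product-isProfinite = restrictions , record
    { ⟦_⟧                  = λ a → (λ _ → a) , λ {l} _ → MVAlgebra.refl (Restriction l) {a}
    ; isMonoidHomomorphism = record
        { isMagmaHomomorphism = record
            { isRelHomomorphism = record { cong = λ a≈b l → All.universal a≈b l }
            ; homo              = λ a b l → MVAlgebra.refl (Restriction l) {a ⊕ b}
            }
        ; ε-homo = λ l → MVAlgebra.refl (Restriction l) {0#}
        }
    ; ~-homo               = λ a l → MVAlgebra.refl (Restriction l) {~ a}
    } , (λ eq x → All.lookup (eq [ x ]) (here ≡.refl)) , λ (f , f-compatible) →
      ((λ x → f [ x ] at x) , (λ x → at≤σ (f [ x ]) x) , λ {x} {y} x≈y →
        -- Singletons of equal coordinates are comparable, so compatibility makes the values respect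
        -- `≈ₓ`.
        ≡.trans (≡.sym (All.head (f-compatible {[ x ]} {[ y ]} λ a b p →
            ≡.trans (at-cong a x≈y) (≡.trans (All.head p) (≡.sym (at-cong b x≈y))) ∷ [])))
          (at-cong (f [ y ]) x≈y)) ,
      λ z≈ l → All.tabulate λ {x} x∈l → ≡.trans (z≈ x)
        (≡.sym (All.head (f-compatible {[ x ]} {l} λ _ _ p → All.lookup p x∈l ∷ [])))

-- Finite MV-algebras

-- If every nonzero element lies above p ≉ 0, the algebra is the finite chain
-- 0 < p < 2p < ⋯ < np ≈ 1, and the index of a multiple of p is a valuation.
module Chain (A : MVAlgebra ℓ) (p : MVAlgebra.Carrier A)
  (p≉0 : ¬ MVAlgebra._≈_ A p (MVAlgebra.0# A))
  (dichotomy : ∀ x → MVAlgebra._≈_ A x (MVAlgebra.0# A) ⊎ MVAlgebra._≤_ A p x) where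
  open MVAlgebra A
  open MVProperties A

  ·-mono-≤ : ∀ {i j} x → i ≤ℕ j → i · x ≤ j · x
  ·-mono-≤ {i} {j} x i≤j = ≤-respʳ (trans (sym (·-homo-+ x (j ∸ i) i))
    (reflexive (≡.cong (_· x) (ℕₚ.m∸n+n≡m i≤j)))) (x≤y⊕x (i · x) ((j ∸ i) · x))
    where
    reflexive : ∀ {x y} → x ≡ y → x ≈ y
    reflexive ≡.refl = refl

  -- Otherwise `p` lies below `~ y`, and subtracting `p` from `~ y` changes nothing, which forces
  -- `p ≈ 0#`.
  p⊕y≤y⇒y≈1 : ∀ {y} → p ⊕ y ≤ y → y ≈ 1#
  p⊕y≤y⇒y≈1 {y} le with dichotomy (~ y)
  ... | inj₁ ~y≈0 = ~-injective (trans ~y≈0 (sym (~-involutive 0#)))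
  ... | inj₂ p≤~y = contradiction p≈0 p≉0
    where
    ~y≤~y⊖p : ~ y ≤ ~ y ⊖ p
    ~y≤~y⊖p = ~-anti-≤ (≤-respˡ (trans (comm p y) (⊕-congʳ (sym (~-involutive y)))) le)
    p≈0 : p ≈ 0#
    p≈0 = trans (sym (x≤y⇒y⊖[y⊖x]≈x p≤~y)) (x≤y⇒x⊖y≈0 ~y≤~y⊖p)

  -- A repeated multiple is stationary: (i + 1) p ≤ j p = i p.
  ·≈⇒≈1 : ∀ {i j} → i < j → i · p ≈ j · p → i · p ≈ 1#
  ·≈⇒≈1 i<j eq = p⊕y≤y⇒y≈1 (≤-respʳ (sym eq) (·-mono-≤ p i<j))

  -- Division by `p`: by the dichotomy, the remainder `x ⊖ j · p` is 0 or still contains `p`.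
  multiple-or-above : ∀ x j → (∃ λ i → i < j × x ≈ i · p) ⊎ j · p ≤ x
  multiple-or-above x zero = inj₂ (0≤x x)
  multiple-or-above x (suc j) with multiple-or-above x j
  ... | inj₁ (i , i<j , eq) = inj₁ (i , ℕₚ.m≤n⇒m≤1+n i<j , eq)
  ... | inj₂ jp≤x with dichotomy (x ⊖ j · p)
  ...   | inj₁ x⊖jp≈0 = inj₁ (j , ℕₚ.≤-refl , ≤-antisym (x⊖y≈0⇒x≤y x⊖jp≈0) jp≤x)
  ...   | inj₂ p≤x⊖jp = inj₂ (≤-respʳ (x≤y⇒y⊖x⊕x≈y jp≤x) (⊕-monoʳ-≤ (j · p) p≤x⊖jp))

  module _ (em : ExcludedMiddle ℓ) (top : ∃ λ n → n · p ≈ 1#) where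
    private
      smallest : ∃ λ n → n · p ≈ 1# × (∀ j → j · p ≈ 1# → n ≤ℕ j)
      smallest = Classical.least em _ top

    length : ℕ
    length = proj₁ smallest

    private
      n·p≈1 : length · p ≈ 1#
      n·p≈1 = proj₁ (proj₂ smallest)

      minimal : ∀ j → 1# ≤ j · p → length ≤ℕ j
      minimal j 1≤jp = proj₂ (proj₂ smallest) j (≤-antisym (x≤1 _) 1≤jp)

      index-of : ∀ x → ∃ λ i → i ≤ℕ length × x ≈ i · p
      index-of x with multiple-or-above x length
      ... | inj₁ (i , i<n , eq) = i , ℕₚ.<⇒≤ i<n , eq
      ... | inj₂ np≤x           = length , ℕₚ.≤-refl , ≤-antisym (≤-respʳ (sym n·p≈1) (x≤1 x)) np≤x

      index : Carrier → ℕ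
      index x = proj₁ (index-of x)

      index≤n : ∀ x → index x ≤ℕ length
      index≤n x = proj₁ (proj₂ (index-of x))

      x≈index·p : ∀ x → x ≈ index x · p
      x≈index·p x = proj₂ (proj₂ (index-of x))

      -- If j < i, the two multiples coincide, hence equal 1, against the minimality of `length`.
      ·p-reflects-≤ : ∀ {i j} → i ≤ℕ length → i · p ≤ j · p → i ≤ℕ j
      ·p-reflects-≤ {i} {j} i≤n le = ℕₚ.≮⇒≥ λ j<i →
        let jp≈1 = ·≈⇒≈1 j<i (≤-antisym (·-mono-≤ p (ℕₚ.<⇒≤ j<i)) le)
        in ℕₚ.<⇒≱ j<i (ℕₚ.≤-trans i≤n (minimal j (≤-reflexive (sym jp≈1))))

      index-unique : ∀ {x i} → i ≤ℕ length → x ≈ i · p → index x ≡ i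
      index-unique {x} i≤n eq = ℕₚ.≤-antisym
        (·p-reflects-≤ (index≤n x) (≤-reflexive (trans (sym (x≈index·p x)) eq)))
        (·p-reflects-≤ i≤n (≤-reflexive (trans (sym eq) (x≈index·p x))))

      ⊓-·p : ∀ k → (length ⊓ k) · p ≈ k · p
      ⊓-·p k with ℕₚ.≤-total k length
      ... | inj₁ k≤n rewrite ℕₚ.m≥n⇒m⊓n≡n k≤n = refl
      ... | inj₂ n≤k rewrite ℕₚ.m≤n⇒m⊓n≡m n≤k =
        ≤-antisym (·-mono-≤ p n≤k) (≤-respʳ (sym n·p≈1) (x≤1 _))

    valuation : Valuation A length
    valuation = record
      { val      = index
      ; val-cong = λ {x} {y} x≈y → index-unique (index≤n y) (trans x≈y (x≈index·p y))
      ; val-0    = index-unique z≤n refl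
      ; val-⊕    = λ x y → index-unique (ℕₚ.m⊓n≤m length _)
          (trans (∙-cong (x≈index·p x) (x≈index·p y))
          (trans (sym (·-homo-+ p (index x) (index y))) (sym (⊓-·p _))))
      ; val-~    = λ x → ℕₚ.≤-antisym
          (ℕₚ.m+n≤o⇒m≤o∸n (index (~ x)) (complement-≤ x))
          -- Since `x ⊕ ~ x ≈ 1#`, the two indices add up to at least `length`.
          (ℕₚ.m≤n+o⇒m∸n≤o length (index x) (minimal _
            (≤-respʳ (sym (·-homo-+ p (index x) (index (~ x))))
            (≤-respʳ (∙-cong (x≈index·p x) (x≈index·p (~ x)))
            (≤-reflexive (sym (trans (comm _ _) ≤-refl)))))))
      }
      where
      -- If the indices of ~ x and x added up to more than n, then
      -- x ⊕ (index (~ x) - 1) · p would still be 1, putting ~ x below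
      -- (index (~ x) - 1) · p.
      complement-≤ : ∀ x → index (~ x) + index x ≤ℕ length
      complement-≤ x with index (~ x) in eq
      ... | zero  = index≤n x
      ... | suc k = ℕₚ.≮⇒≥ λ n<1+k+i → ℕₚ.1+n≰n (≡.subst (_≤ℕ k) eq
        (·p-reflects-≤ (index≤n (~ x)) (≤-respˡ (x≈index·p (~ x)) (begin
          ~ ~ x ⊕ k · p              ≈⟨ ⊕-congʳ (trans (~-involutive x) (x≈index·p x)) ⟩
          index x · p ⊕ k · p        ≈⟨ comm _ _ ⟩
          k · p ⊕ index x · p        ≈⟨ ·-homo-+ p k (index x) ⟨
          (k + index x) · p          ≈⟨ ≤-antisym (x≤1 _) (≤-respˡ n·p≈1 (·-mono-≤ p (ℕₚ.≤-pred n<1+k+i))) ⟩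
          1#                         ∎))))
        where open SetoidReasoning setoid

    val≡0⇒≈0 : ∀ {x} → Valuation.val valuation x ≡ 0 → x ≈ 0#
    val≡0⇒≈0 {x} eq = trans (x≈index·p x) (≡.subst (λ k → k · p ≈ 0#) (≡.sym eq) refl)

    length-nonZero : NonZero length
    length-nonZero = ≢-nonZero λ n≡0 → p≉0 (x≤0⇒x≈0 (≤-respʳ
      (trans (sym n·p≈1) (≡.subst (λ k → k · p ≈ 0#) (≡.sym n≡0) refl)) (x≤1 p)))

-- Quotients by ideals

module IdealCongruence (A : MVAlgebra ℓ) {I : MVAlgebra.Carrier A → Set ℓ} (I-ideal : MVAlgebra.IsIdeal A I) where
  open MVAlgebra A
  open MVProperties A
  open IsIdeal I-ideal

  infix 4 _∼_
  _∼_ : Carrier → Carrier → Set ℓ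
  x ∼ y = I (x ⊖ y) × I (y ⊖ x)

  private
    I-resp : ∀ {x y} → x ≈ y → I x → I y
    I-resp x≈y = down-closed (≤-reflexive (sym x≈y))

    ≤⇒I : ∀ {x y} → x ≤ y → I (x ⊖ y)
    ≤⇒I x≤y = I-resp (sym (x≤y⇒x⊖y≈0 x≤y)) (0∈ideal I-ideal)

    x≤y⊕[x⊖y] : ∀ x y → x ≤ y ⊕ (x ⊖ y)
    x≤y⊕[x⊖y] x y = ≤-respʳ (comm _ _) (x≤x∨y x y)

    -- Triangle inequality: `x ⊖ z` lies below `(y ⊖ z) ⊕ (x ⊖ y)`.
    I-trans : ∀ {x y z} → I (x ⊖ y) → I (y ⊖ z) → I (x ⊖ z)
    I-trans {x} {y} {z} p q = down-closed (⊖-residualʳ (≤-trans (x≤y⊕[x⊖y] x y)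
      (≤-respʳ (assoc _ _ _) (⊕-monoʳ-≤ (x ⊖ y) (x≤y⊕[x⊖y] y z))))) (⊕-closed q p)

    -- The difference of the sums lies below the sum of the differences.
    I-⊕ : ∀ {x y z w} → I (x ⊖ y) → I (z ⊖ w) → I (x ⊕ z ⊖ (y ⊕ w))
    I-⊕ {x} {y} {z} {w} p q = down-closed (⊖-residualʳ (≤-respʳ
      (trans (assoc _ _ _) (trans (⊕-congˡ (trans (sym (assoc _ _ _))
        (trans (⊕-congʳ (comm _ w)) (assoc _ _ _)))) (sym (assoc _ _ _))))
      (⊕-mono-≤ (x≤y⊕[x⊖y] x y) (x≤y⊕[x⊖y] z w)))) (⊕-closed p q)

  ≈⇒∼ : ∀ {x y} → x ≈ y → x ∼ y
  ≈⇒∼ x≈y = ≤⇒I (≤-reflexive x≈y) , ≤⇒I (≤-reflexive (sym x≈y))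

  ∈I⇒∼0 : ∀ {x} → I x → x ∼ 0#
  ∈I⇒∼0 x∈I = I-resp (sym (⊖-identityʳ _)) x∈I , ≤⇒I (0≤x _)

  ∼0⇒∈I : ∀ {x} → x ∼ 0# → I x
  ∼0⇒∈I (p , _) = I-resp (⊖-identityʳ _) p

  Quotient : MVAlgebra ℓ
  Quotient = coarsen _∼_
    (record
      { refl  = ≈⇒∼ refl
      ; sym   = λ (p , q) → q , p
      ; trans = λ (p , q) (p′ , q′) → I-trans p p′ , I-trans q′ q
      })
    ≈⇒∼
    (λ (p , q) (p′ , q′) → I-⊕ p p′ , I-⊕ q q′)
    (λ (p , q) → I-resp (sym (~x⊖~y≈y⊖x _ _)) q , I-resp (sym (~x⊖~y≈y⊖x _ _)) p)

  quotientMap : MVHom A Quotient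
  quotientMap = record
    { ⟦_⟧                  = λ x → x
    ; isMonoidHomomorphism = record
        { isMagmaHomomorphism = record
            { isRelHomomorphism = record { cong = ≈⇒∼ }
            ; homo              = λ _ _ → ≈⇒∼ refl
            }
        ; ε-homo = ≈⇒∼ refl
        }
    ; ~-homo               = λ _ → ≈⇒∼ refl
    }

-- Atoms and separating valuations of a finite algebra

module FiniteMVAlgebra (em : ExcludedMiddle ℓ) (A : MVAlgebra ℓ) (finite : IsFinite A) where
  open MVAlgebra A
  open MVProperties A
  open Inverse (proj₂ finite) using (to; from; inverseˡ)

  private
    size : ℕ
    size = proj₁ finite

    to∘from : ∀ x → to (from x) ≈ x
    to∘from x = inverseˡ ≡.refl

  elements : List Carrier
  elements = map to (allFin size)

  All-elements : ∀ {P : Carrier → Set ℓ} → (∀ {x y} → x ≈ y → P x → P y) → All P elements → ∀ x → P x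
  All-elements resp all x = resp (to∘from x) (All.lookup all (∈-map⁺ to (∈-allFin (from x))))

  ·-repeats : ∀ x → ∃ λ i → ∃ λ j → i < j × i · x ≈ j · x
  ·-repeats x with Finₚ.pigeonhole (ℕₚ.n<1+n size) (λ i → from (toℕ i · x))
  ... | i , j , i<j , eq = toℕ i , toℕ j , i<j ,
    trans (sym (to∘from _)) (inverseˡ eq)

  module _ {d : Carrier} (d≉0 : ¬ d ≈ 0#) where

    -- Starting from `d`, run through all elements and replace the candidate by each nonzero element
    -- below it.
    atom : ∃ λ p → ¬ p ≈ 0# × p ≤ d × (∀ x → x ≤ p → x ≈ 0# ⊎ p ≤ x)
    atom = let p , p≉0 , p≤d , minimal = go elements in p , p≉0 , p≤d ,
      All-elements (λ x≈y h y≤p → [ (λ x≈0 → inj₁ (trans (sym x≈y) x≈0)) ,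
        (λ p≤x → inj₂ (≤-respʳ x≈y p≤x)) ]′ (h (≤-respˡ (sym x≈y) y≤p))) minimal
      where
      go : ∀ (l : List Carrier) → ∃ λ p → ¬ p ≈ 0# × p ≤ d × All (λ x → x ≤ p → x ≈ 0# ⊎ p ≤ x) l
      go [] = d , d≉0 , ≤-refl , []
      go (x ∷ l) with go l | em {x ≈ 0#} | em {x ≤ proj₁ (go l)}
      ... | p , p≉0 , p≤d , minimal | yes x≈0 | _       = p , p≉0 , p≤d , (λ _ → inj₁ x≈0) ∷ minimal
      ... | p , p≉0 , p≤d , minimal | no _    | no x≰p  = p , p≉0 , p≤d , (λ x≤p → contradiction x≤p x≰p) ∷ minimal
      ... | p , p≉0 , p≤d , minimal | no x≉0  | yes x≤p = x , x≉0 , ≤-trans x≤p p≤d , (λ _ → inj₂ ≤-refl) ∷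
        All.map (λ h y≤x → [ inj₁ , (λ p≤y → inj₂ (≤-trans x≤p p≤y)) ]′ (h (≤-trans y≤x x≤p))) minimal

    -- Modulo the elements disjoint from an atom p, the algebra is a chain with
    -- least nonzero element p.
    valuation-nonzero-at : ∃ λ n → NonZero n × Σ (Valuation A n) λ v → ¬ Valuation.val v d ≡ 0
    valuation-nonzero-at = C.length em top , C.length-nonZero em top ,
      pullback quotientMap (C.valuation em top) , λ vd≡0 → d∉I (∼0⇒∈I (C.val≡0⇒≈0 em top {d} vd≡0))
      where
      p : Carrier
      p = proj₁ atom
      p≉0 : ¬ p ≈ 0#
      p≉0 = proj₁ (proj₂ atom)
      p≤d : p ≤ d
      p≤d = proj₁ (proj₂ (proj₂ atom))
      p-minimal : ∀ x → x ≤ p → x ≈ 0# ⊎ p ≤ x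
      p-minimal = proj₂ (proj₂ (proj₂ atom))
      I : Carrier → Set ℓ
      I x = p ⊖ x ≈ p
      I-ideal : IsIdeal I
      I-ideal = record
        { nonempty    = 0# , ⊖-identityʳ p
        ; ⊕-closed    = λ {x} {y} x∈I y∈I → trans (sym (⊖-⊖-assoc p x y)) (trans (⊖-cong x∈I refl) y∈I)
        ; down-closed = λ {x} {y} x≤y y∈I → ≤-antisym (x⊖y≤x p x) (≤-respˡ y∈I (⊖-monoʳ-≤ p x≤y))
        }
      open IdealCongruence A I-ideal
      ≥p⇒∉I : ∀ {x} → p ≤ x → ¬ I x
      ≥p⇒∉I p≤x x∈I = p≉0 (trans (sym x∈I) (x≤y⇒x⊖y≈0 p≤x))
      d∉I : ¬ I d
      d∉I = ≥p⇒∉I p≤d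
      dichotomy : ∀ x → x ∼ 0# ⊎ MVAlgebra._≤_ Quotient p x
      -- The meet of the atom `p` with `x` is 0 or `p`.
      dichotomy x with p-minimal (p ⊖ (p ⊖ x)) (x⊖y≤x p (p ⊖ x))
      ... | inj₁ meet≈0 = inj₁ (∈I⇒∼0 (≤-antisym (x⊖y≤x p x) (x⊖y≈0⇒x≤y meet≈0)))
      ... | inj₂ p≤meet = inj₂ (≈⇒∼ (≤-trans p≤meet (x⊖[x⊖y]≤y p x)))
      module C = Chain Quotient p (λ p∼0 → ≥p⇒∉I ≤-refl (∼0⇒∈I p∼0)) dichotomy
      top : ∃ λ n → MVAlgebra._≈_ Quotient (MVAlgebra._·_ Quotient n p) 1#
      -- By finiteness a multiple of `p` repeats, and in the quotient a repeated multiple is 1.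
      top = let i , j , i<j , eq = ·-repeats p in i , C.·≈⇒≈1 i<j (quotient-· i j eq)
        where
        module Q = MVAlgebra Quotient
        quotient-· : ∀ i j → i · p ≈ j · p → i Q.· p ∼ j Q.· p
        quotient-· i j eq = Q.trans (Q.sym (MVHomProperties.·-homo quotientMap i p))
          (Q.trans (≈⇒∼ eq) (MVHomProperties.·-homo quotientMap j p))

-- Inverse limits

module Limit (em : ExcludedMiddle ℓ) (S : FiniteInverseSystem ℓ) where
  open FiniteInverseSystem S renaming (map to transition)
  open Poset index using () renaming (Carrier to Index; _≤_ to _≤ᵢ_)
  open MVAlgebra (limit S)
  open MVProperties (limit S)
  private
    module A i = MVAlgebra (alg i)
    module Aₚ i = MVProperties (alg i)

  projection : ∀ i → MVHom (limit S) (alg i)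
  projection i = record
    { ⟦_⟧                  = λ a → proj₁ a i
    ; isMonoidHomomorphism = record
        { isMagmaHomomorphism = record
            { isRelHomomorphism = record { cong = λ a≈b → a≈b i }
            ; homo              = λ _ _ → A.refl i
            }
        ; ε-homo = A.refl i
        }
    ; ~-homo               = λ _ → A.refl i
    }

  private
    π : ∀ i → Carrier → A.Carrier i
    π i a = proj₁ a i

  -- Suprema of join-closed sets

  module _ {K : Carrier → Set ℓ} (k₀ : Carrier) (k₀∈K : K k₀) (K-∨ : ∀ {x y} → K x → K y → K (x ∨ y)) where
    private
      Image : ∀ i → A.Carrier i → Set ℓ
      Image i x = ∃ λ k → K k × A._≈_ i (π i k) x

      -- Joining one member of `K` for each element of its image in the finite factor bounds that
      -- image.
      maximum : ∀ i → ∃ λ k → K k × (∀ x → Image i x → A._≤_ i x (π i k))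
      maximum i = let k , k∈K , bounds = go elements in k , k∈K ,
        All-elements (λ x≈y h (k′ , k′∈K , eq) →
          Aₚ.≤-respˡ i x≈y (h (k′ , k′∈K , A.trans i eq (A.sym i x≈y)))) bounds
        where
        open FiniteMVAlgebra em (alg i) (finite i)
        go : ∀ l → ∃ λ k → K k × All (λ x → Image i x → A._≤_ i x (π i k)) l
        go [] = k₀ , k₀∈K , []
        go (x ∷ l) with go l | em {Image i x}
        ... | k , k∈K , bounds | no x∉ = k , k∈K , (λ x∈ → contradiction x∈ x∉) ∷ bounds
        ... | k , k∈K , bounds | yes (k′ , k′∈K , eq) = k ∨ k′ , K-∨ k∈K k′∈K ,
          (λ _ → Aₚ.≤-respˡ i eq (Aₚ.y≤x∨y i (π i k) (π i k′))) ∷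
          All.map (λ h x∈ → Aₚ.≤-trans i (h x∈) (Aₚ.x≤x∨y i (π i k) (π i k′))) bounds

      top : ∀ i → Carrier
      top i = proj₁ (maximum i)

      top∈K : ∀ i → K (top i)
      top∈K i = proj₁ (proj₂ (maximum i))

      π≤π-top : ∀ i {k} → K k → A._≤_ i (π i k) (π i (top i))
      π≤π-top i k∈K = proj₂ (proj₂ (maximum i)) _ (_ , k∈K , A.refl i)

    -- Different factors may use different members of `K`. For i ≤ j the maxima are still
    -- compatible, since `top i` and `top j` bound each other in the factors i and j.
    sup : Carrier
    sup = (λ i → π i (top i)) , λ {i} {j} i≤j → Aₚ.≤-antisym i
      (Aₚ.≤-respˡ i (A.sym i (proj₂ (top j) i≤j)) (π≤π-top i (top∈K j)))
      (Aₚ.≤-respˡ i (proj₂ (top i) i≤j)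
        (MVHomProperties.mono-≤ (transition i≤j) (π≤π-top j (top∈K i))))

    ≤-sup : ∀ {k} → K k → k ≤ sup
    ≤-sup k∈K i = π≤π-top i k∈K

    sup-attained : ∀ i → ∃ λ k → K k × A._≈_ i (π i sup) (π i k)
    sup-attained i = top i , top∈K i , A.refl i

  -- Continuous points of an inverse limit

  Continuous : ∀ {n} → Valuation (limit S) n → Set ℓ
  Continuous v = ∃ λ i → ∀ {a b} → A._≈_ i (π i a) (π i b) → Valuation.val v a ≡ Valuation.val v b

  -- Continuity puts the supremum of the kernel into the kernel.
  kernel-top : ∀ {n} (v : Valuation (limit S) n) → Continuous v →
    ∃ λ e → Valuation.val v e ≡ 0 × (∀ {x} → Valuation.val v x ≡ 0 → x ≤ e)
  kernel-top {n} v (i , continuous) = sup′ , ve≡0 , λ {x} vx≡0 →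
    ≤-sup {kernel} 0# (lift val-0) (λ {x} {y} → ∨-closed {x} {y}) {x} (lift vx≡0)
    where
    open Valuation v
    ∨-closed : ∀ {x y} → kernel x → kernel y → kernel (x ∨ y)
    ∨-closed {x} {y} (lift vx≡0) (lift vy≡0) = lift (ℕₚ.n≤0⇒n≡0
      (val-∨-≤ {x} {y} (ℕₚ.≤-reflexive vx≡0) (ℕₚ.≤-reflexive vy≡0)))
    sup′ : Carrier
    sup′ = sup {kernel} 0# (lift val-0) (λ {x} {y} → ∨-closed {x} {y})
    ve≡0 : val sup′ ≡ 0
    ve≡0 = let k , lift vk≡0 , eq = sup-attained {kernel} 0# (lift val-0) (λ {x} {y} → ∨-closed {x} {y}) i
           in ≡.trans (continuous {sup′} {k} eq) vk≡0

  -- Continuity is carried as data because a supremum agrees with members of the set only in one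
  -- finite factor at a time.
  ContinuousPoint : Set ℓ
  ContinuousPoint = Σ (Point (limit S)) λ P → Continuous (Point.valuation P)

  spectrum : Multiset ℓ
  spectrum = record
    { X         = On.setoid {B = ContinuousPoint} (pointSetoid (limit S)) proj₁
    ; σ         = record { to = λ (P , _) → Point.deg P ; cong = proj₁ }
    ; σ-nonZero = λ (P , _) → Point.deg-nonZero P
    }

  continuousEvaluate : MVHom (limit S) (Product spectrum)
  continuousEvaluate = tuple spectrum (λ (P , _) → Point.valuation P) proj₂

  private
    -- A valuation of the finite factor that is nonzero at the difference, pulled back and
    -- normalised, is a continuous point at which `a` and `b` differ.
    separate : ∀ i {a b} → ¬ A._≈_ i (Aₚ._⊖_ i (π i a) (π i b)) (A.0# i) → 
      ¬ MVAlgebra._≈_ (Product spectrum) (MVHom.⟦ continuousEvaluate ⟧ a) (MVHom.⟦ continuousEvaluate ⟧ b)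
    separate i {a} {b} d≉0 eq = vd≢0 (≡.trans (v.val-⊖ (π i a) (π i b)) (ℕₚ.m≤n⇒m∸n≡0 (ℕₚ.≤-reflexive
      (≡.trans (N.val≡scale*val a) (≡.trans (≡.cong (N.scale *_) (eq (P , continuous)))
        (≡.sym (N.val≡scale*val b)))))))
      where
      valuation = FiniteMVAlgebra.valuation-nonzero-at em (alg i) (finite i) d≉0
      v = proj₁ (proj₂ (proj₂ valuation))
      module v = Valuation v
      vd≢0 = proj₂ (proj₂ (proj₂ valuation))
      module N = Classical.Normalisation
        (Classical.normalise em {{proj₁ (proj₂ valuation)}} (pullback (projection i) v))
      continuous : Continuous N.valuation
      continuous = i , λ {a} {b} eq → ℕₚ.*-cancelˡ-≡ _ _ N.scale {{N.scale-nonZero}}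
        (≡.trans (≡.sym (N.val≡scale*val a)) (≡.trans (v.val-cong eq) (N.val≡scale*val b)))
      P : Point (limit S)
      P = let e , ve≡0 , top = kernel-top N.valuation continuous in record
        { deg         = N.deg
        ; deg-nonZero = N.deg-nonZero
        ; valuation   = N.valuation
        ; unit        = N.unit
        ; val-unit    = N.val-unit
        ; gen         = e
        ; val-gen     = ve≡0
        ; gen-top     = λ {x} vx≡0 → ⟨⟩-containing {x} {e} (top {x} vx≡0)
        }

  continuousEvaluate-injective : ∀ {a b} →
    MVAlgebra._≈_ (Product spectrum) (MVHom.⟦ continuousEvaluate ⟧ a) (MVHom.⟦ continuousEvaluate ⟧ b) →
    a ≈ b
  continuousEvaluate-injective {a} {b} eq i = Aₚ.≤-antisym i
    (Aₚ.x⊖y≈0⇒x≤y i (decidable-stable em λ d≉0 → separate i {a} {b} d≉0 eq))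
    (Aₚ.x⊖y≈0⇒x≤y i (decidable-stable em λ d≉0 → separate i {b} {a} d≉0 λ P → ≡.sym (eq P)))

  module _ (f : MVAlgebra.Carrier (Product spectrum)) where
    private
      module F = ProductProperties spectrum

      Below : Carrier → Set ℓ
      Below k = ∀ P → Point.val (proj₁ P) k ≤ℕ f F.at P

      0∈Below : Below 0#
      0∈Below = λ (P , _) → ℕₚ.≤-trans (ℕₚ.≤-reflexive (Point.val-0 P)) z≤n

      ∨-closed : ∀ {x y} → Below x → Below y → Below (x ∨ y)
      ∨-closed {x} {y} x≤f y≤f (P , c) = Point.val-∨-≤ P {x} {y} (x≤f (P , c)) (y≤f (P , c))

    preimage : Carrier
    preimage = sup {Below} 0# 0∈Below (λ {x} {y} → ∨-closed {x} {y})

    private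
      preimage≤ : ∀ P → Point.val (proj₁ P) preimage ≤ℕ f F.at P
      preimage≤ P@(_ , i , continuous) =
        let k , k≤f , eq = sup-attained {Below} 0# 0∈Below (λ {x} {y} → ∨-closed {x} {y}) i
        in ℕₚ.≤-trans (ℕₚ.≤-reflexive (continuous {preimage} {k} eq)) (k≤f P)

      -- Every value of f at P is attained at P by an element vanishing at all
      -- other points.
      ≤preimage : ∀ P → f F.at P ≤ℕ Point.val (proj₁ P) preimage
      ≤preimage (P , P-continuous) = ℕₚ.≤-trans (ℕₚ.≤-reflexive (≡.sym Pk≡fP))
        (P.val-mono-≤ {k} {preimage} (≤-sup {Below} 0# 0∈Below (λ {x} {y} → ∨-closed {x} {y}) {k} k≤f))
        where
        module P = Point P
        e : Carrier
        e = proj₁ (kernel-top P.valuation P-continuous)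
        Pe≡0 : P.val e ≡ 0
        Pe≡0 = proj₁ (proj₂ (kernel-top P.valuation P-continuous))
        e-top : ∀ {x} → P.val x ≡ 0 → x ≤ e
        e-top = proj₂ (proj₂ (kernel-top P.valuation P-continuous))
        fP : ℕ
        fP = f F.at (P , P-continuous)
        b : Carrier
        b = fP · P.unit
        Pb≡fP : P.val b ≡ fP
        Pb≡fP = P.val-k·unit (F.at≤σ f (P , P-continuous))
        k : Carrier
        k = b ⊖ e
        Pk≡fP : P.val k ≡ fP
        Pk≡fP = ≡.trans (P.val-⊖ b e) (≡.cong₂ _∸_ Pb≡fP Pe≡0)
        -- The top of a kernel is idempotent, so each point takes the value 0 or its full degree
        -- there.
        e⊕e≤e : e ⊕ e ≤ e
        e⊕e≤e = e-top (≡.trans (P.val-⊕ e e)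
          (≡.trans (≡.cong₂ (λ i j → P.deg ⊓ (i + j)) Pe≡0 Pe≡0) (ℕₚ.⊓-zeroʳ P.deg)))
        k≤f : ∀ Q → Point.val (proj₁ Q) k ≤ℕ f F.at Q
        k≤f (Q , Q-continuous) with Point.val Q e in Qe
        -- Vanishing at `e` makes `Q` vanish on the kernel of `P`, so the two points are equal.
        ... | zero = ℕₚ.≤-reflexive (≡.trans (≡.sym (proj₂ P≈Q k)) (≡.trans Pk≡fP (F.at-cong f P≈Q)))
          where
          P≈Q : P ≈ₚ Q
          P≈Q = ⊆ₖ⇒≈ₚ P Q λ {x} Px≡0 → ℕₚ.n≤0⇒n≡0 (ℕₚ.≤-trans
            (Point.val-mono-≤ Q {x} {e} (e-top {x} Px≡0)) (ℕₚ.≤-reflexive Qe))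
        -- Here `Q` takes its full degree at `e`, so subtracting `e` leaves 0.
        ... | suc m = ℕₚ.≤-trans (ℕₚ.≤-reflexive (≡.trans (Q.val-⊖ b e)
            (ℕₚ.m≤n⇒m∸n≡0 (ℕₚ.≤-trans (Q.val≤n b) n≤Qe)))) z≤n
          where
          module Q = Point Q
          n≤Qe : Q.deg ≤ℕ Q.val e
          -- A value strictly between 0 and the degree would grow on passing to `e ⊕ e`.
          n≤Qe = ℕₚ.≮⇒≥ λ Qe<n → ℕₚ.<⇒≱
            (ℕₚ.⊓-glb Qe<n (ℕₚ.+-monoˡ-≤ (Q.val e) (≡.subst (1 ≤ℕ_) (≡.sym Qe) (s≤s z≤n))))
            (ℕₚ.≤-trans (ℕₚ.≤-reflexive (≡.sym (Q.val-⊕ e e))) (Q.val-mono-≤ {e ⊕ e} {e} e⊕e≤e))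

    continuousEvaluate-preimage : ∀ P → Point.val (proj₁ P) preimage ≡ f F.at P
    continuousEvaluate-preimage P = ℕₚ.≤-antisym (preimage≤ P) (≤preimage P)

  continuousEvaluate-isIsomorphism : IsIsomorphism continuousEvaluate
  continuousEvaluate-isIsomorphism = (λ {a} {b} → continuousEvaluate-injective {a} {b}) , λ f → preimage f ,
    λ {z} z≈ P → ≡.trans (Point.val-cong (proj₁ P) {z} {preimage f} z≈) (continuousEvaluate-preimage f P)

-- The equivalence

module _ (em : ExcludedMiddle ℓ) where

  -- Any representation of A as a product of chains makes every point of A a
  -- coordinate of that product.
  evaluate-isIsomorphism : ∀ {A : MVAlgebra ℓ} (M : Multiset ℓ) (θ : MVHom A (Product M)) →
    IsIsomorphism θ → IsIsomorphism (evaluate A)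
  evaluate-isIsomorphism {A} M θ θ-iso =
    (λ eq → injective λ x → eq (coordinate x)) ,
    λ f → from (reindex f) , λ z≈ P → let x , P≈x = coordinate-of P in
      ≡.trans (Point.val-cong P z≈) (≡.trans (proj₂ P≈x _)
        (≡.trans (to∘from (reindex f) x) (≡.sym (proj₂ (proj₂ f) P≈x))))
    where
    open ProductProperties M
    open IsomorphismProperties θ θ-iso
    coordinate : ∣X∣ → Point A
    coordinate x = pullbackPoint θ θ-iso (evaluationPoint em x)
    coordinate-of : ∀ P → ∃ λ x → P ≈ₚ coordinate x
    coordinate-of P =
      let x , deg≡ , val≡ = point≈evaluation em (pullbackPoint inverse inverse-isIsomorphism P)
      in x , deg≡ , λ a → ≡.trans (Point.val-cong P (MVAlgebra.sym A (from∘to a))) (val≡ (MVHom.⟦ θ ⟧ a))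
    reindex : MVAlgebra.Carrier (Product (Spec A)) → Carrier
    reindex (f , f≤ , f-cong) = (λ x → f (coordinate x)) , (λ x → f≤ (coordinate x)) ,
      λ x≈y → f-cong (σ-cong x≈y , λ a → at-cong (MVHom.⟦ θ ⟧ a) x≈y)

  evaluate-profinite : ∀ {A : MVAlgebra ℓ} → IsProfinite A → IsIsomorphism (evaluate A)
  evaluate-profinite {A} (S , φ , φ-iso) = evaluate-isIsomorphism spectrum (continuousEvaluate ∘MV φ)
    (Comp.bijective (MVAlgebra._≈_ A) (MVAlgebra._≈_ (limit S)) (MVAlgebra._≈_ (Product spectrum))
      {MVHom.⟦ φ ⟧} {MVHom.⟦ continuousEvaluate ⟧}
      φ-iso continuousEvaluate-isIsomorphism)
    where open Limit em S

  private
    -- Makes quotients independent of the divisibility proofs that store them.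
    scales-agree : ∀ q q′ {m m′} .{{_ : NonZero m}} → q * m ≡ q′ * m′ → m ≡ m′ → q ≡ q′
    scales-agree _ _ eq ≡.refl = ℕₚ.*-cancelʳ-≡ _ _ _ eq

  -- From multiset morphisms to homomorphisms

  module _ {M N : Multiset ℓ} (φ : MultisetHom M N) where
    private
      module M = ProductProperties M
      module N = ProductProperties N
      module φ = MultisetHom φ

    ratio : M.∣X∣ → ℕ
    ratio x = _∣_.quotient (φ.divides x)

    σ≡ratio*σ : ∀ x → M.σ x ≡ ratio x * N.σ (φ.to x)
    σ≡ratio*σ x = _∣_.equality (φ.divides x)

    ratio-nonZero : ∀ x → NonZero (ratio x)
    ratio-nonZero x = ≢-nonZero λ q≡0 → ≢-nonZero⁻¹ (M.σ x) {{M.σ-nonZero x}}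
      (≡.trans (σ≡ratio*σ x) (≡.cong (_* N.σ (φ.to x)) q≡0))

    -- Precomposition with `φ`, followed at `x` by the inclusion of chains that multiplies by
    -- `ratio x`.
    reindexing : MVHom (Product N) (Product M)
    reindexing = tuple M (λ x → rescale (ratio x) (N.evaluation (φ.to x)) (σ≡ratio*σ x)) λ {x} {y} x≈y b →
      ≡.cong₂ _*_ (scales-agree (ratio x) (ratio y) {{N.σ-nonZero (φ.to x)}}
          (≡.trans (≡.sym (σ≡ratio*σ x)) (≡.trans (M.σ-cong x≈y) (σ≡ratio*σ y)))
          (N.σ-cong (φ.cong x≈y)))
        (N.at-cong b (φ.cong x≈y))

    -- If `J` is the kernel at `x`, its preimage is the kernel at `φ.to x`, because a positive ratio
    -- creates no zeros.
    reindexing-reflects : ReflectsPrincipalMaximalIdeals reindexing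
    reindexing-reflects J J-pm =
      let x , J⊆ , ⊆J = M.principalMaximal⇒evaluation em J-pm
      in IsPrincipalMaximalIdeal-resp-≐ (Product N)
        (λ (lift b≡0) → ⊆J (≡.trans (≡.cong (ratio x *_) b≡0) (ℕₚ.*-zeroʳ (ratio x))))
        (λ {b} b∈ → lift (m*n≡0⇒n≡0 (ratio x) _ {{ratio-nonZero x}} (J⊆ b∈)))
        (Point.kernel-isPrincipalMaximal (N.evaluationPoint em (φ.to x)))

  -- From homomorphisms to multiset morphisms

  module _ {A B : MVAlgebra ℓ} (φ : MVHom A B) (φ-reflects : ReflectsPrincipalMaximalIdeals φ) where
    open MVHom φ

    -- A pulled-back point may lose values, so it is rescaled to become onto again.
    normalisedPullback : (P : Point B) → Classical.Normalisation em (pullback φ (Point.valuation P))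
    normalisedPullback P = Classical.normalise em {{Point.deg-nonZero P}} (pullback φ (Point.valuation P))

    module _ (P : Point B) where
      private
        module P = Point P
        module N = Classical.Normalisation (normalisedPullback P)

      restrict-kernel : ∀ {a} → N.val a ≡ 0 → P.val ⟦ a ⟧ ≡ 0
      restrict-kernel {a} Na≡0 = ≡.trans (N.val≡scale*val a)
        (≡.trans (≡.cong (N.scale *_) Na≡0) (ℕₚ.*-zeroʳ N.scale))

      kernel-restrict : ∀ {a} → P.val ⟦ a ⟧ ≡ 0 → N.val a ≡ 0
      kernel-restrict {a} Pφa≡0 = m*n≡0⇒n≡0 N.scale _ {{N.scale-nonZero}}
        (≡.trans (≡.sym (N.val≡scale*val a)) Pφa≡0)

      restrict : Point A
      restrict = record
        { deg         = N.deg
        ; deg-nonZero = N.deg-nonZero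
        ; valuation   = N.valuation
        ; unit        = N.unit
        ; val-unit    = N.val-unit
        ; gen         = proj₁ principal
        ; val-gen     = kernel-restrict (lower (proj₂ (proj₂ principal)
            (MVProperties.⟨⟩-containing A (MVProperties.≤-refl A))))
        ; gen-top     = λ Na≡0 → proj₁ (proj₂ principal) (lift (restrict-kernel Na≡0))
        }
        where
        -- Reflection of principal maximal ideals supplies a generator of the kernel.
        principal = proj₂ (φ-reflects P.kernel (P.kernel-isPrincipalMaximal))

    restriction : MultisetHom (Spec B) (Spec A)
    restriction = record
      { func    = record
          { to   = restrict
          ; cong = λ {P} {Q} P≈Q → ⊆ₖ⇒≈ₚ (restrict P) (restrict Q) λ a≡0 →
              kernel-restrict Q (≡.trans (≡.sym (proj₂ P≈Q _)) (restrict-kernel P a≡0))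
          }
      ; divides = λ P → let module N = Classical.Normalisation (normalisedPullback P)
                        in divides N.scale N.n≡scale*deg
      }

  -- Functors and natural isomorphisms

  ProductF : Functor (𝕄 ℓ) ((ℙ ℓ) ᵒᵖ)
  ProductF = record
    { F₀     = λ M → Product M , Product-isProfinite em M
    ; F₁     = λ φ → reindexing φ , reindexing-reflects φ
    ; F-cong = λ {M} {N} {φ} {ψ} φ≈ψ b x → let module N = ProductProperties N in
        ≡.cong₂ _*_ (scales-agree (ratio φ x) (ratio ψ x) {{N.σ-nonZero (to φ x)}}
            (≡.trans (≡.sym (σ≡ratio*σ φ x)) (σ≡ratio*σ ψ x)) (N.σ-cong (φ≈ψ x)))
          (N.at-cong b (φ≈ψ x))
    ; F-id   = λ b x → ℕₚ.*-identityˡ _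
    ; F-∙    = λ {L} {M} {N} {ψ} {φ} c x → let module N = ProductProperties N in
        -- Ratios multiply along composites.
        ≡.trans (≡.cong (_* (c N.at to ψ (to φ x))) (scales-agree
          (ratio (Category._∙_ (𝕄 ℓ) ψ φ) x) (ratio φ x * ratio ψ (to φ x)) {{N.σ-nonZero (to ψ (to φ x))}}
          (≡.trans (≡.sym (σ≡ratio*σ (Category._∙_ (𝕄 ℓ) ψ φ) x)) (≡.trans (σ≡ratio*σ φ x)
            (≡.trans (≡.cong (ratio φ x *_) (σ≡ratio*σ ψ (to φ x)))
              (≡.sym (ℕₚ.*-assoc (ratio φ x) (ratio ψ (to φ x)) _))))) ≡.refl))
          (ℕₚ.*-assoc (ratio φ x) (ratio ψ (to φ x)) _)
    }
    where open MultisetHom using (to)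

  SpecF : Functor ((ℙ ℓ) ᵒᵖ) (𝕄 ℓ)
  SpecF = record
    { F₀     = λ (A , _) → Spec A
    ; F₁     = λ (φ , φ-reflects) → restriction φ φ-reflects
    ; F-cong = λ {(A , _)} {(B , _)} {(φ , φ-r)} {(ψ , ψ-r)} φ≈ψ P →
        ⊆ₖ⇒≈ₚ (restrict φ φ-r P) (restrict ψ ψ-r P) λ b≡0 → kernel-restrict ψ ψ-r P
          (≡.trans (≡.sym (Point.val-cong P (φ≈ψ _))) (restrict-kernel φ φ-r P b≡0))
    ; F-id   = λ {(A , _)} P → ⊆ₖ⇒≈ₚ (restrict idMV (λ J pm → pm) P) P
        (restrict-kernel idMV (λ J pm → pm) P)
    ; F-∙    = λ {_} {_} {_} {(φ , φ-r)} {(ψ , ψ-r)} P →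
        ⊆ₖ⇒≈ₚ (restrict (ψ ∘MV φ) (λ J pm → φ-r _ (ψ-r J pm)) P) (restrict φ φ-r (restrict ψ ψ-r P)) λ a≡0 →
          kernel-restrict φ φ-r (restrict ψ ψ-r P) (kernel-restrict ψ ψ-r P
            (restrict-kernel (ψ ∘MV φ) (λ J pm → φ-r _ (ψ-r J pm)) P a≡0))
    }

  unit : NaturalIsomorphism idF (SpecF ∘F ProductF)
  unit = record
    { η        = λ M → let open ProductProperties M in record
        { func    = record { to = evaluationPoint em ; cong = evaluationPoint-cong em }
        ; divides = λ _ → ∣-refl
        }
    ; η⁻¹      = λ M → let open ProductProperties M in record
        { func    = record
            { to   = location em
            ; cong = λ {P} {Q} → location-cong em P Q
            }
        ; divides = λ P → ∣-reflexive (≡.sym (proj₁ (P≈evaluation-location em P)))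
        }
    ; natural  = λ {M} {N} φ x → ⊆ₖ⇒≈ₚ (ProductProperties.evaluationPoint N em (MultisetHom.to φ x))
        (restrict (reindexing φ) (reindexing-reflects φ) (ProductProperties.evaluationPoint M em x)) λ b≡0 →
          kernel-restrict (reindexing φ) (reindexing-reflects φ) (ProductProperties.evaluationPoint M em x)
            (≡.trans (≡.cong (ratio φ x *_) b≡0) (ℕₚ.*-zeroʳ (ratio φ x)))
    ; inverseˡ = λ M → ProductProperties.location-evaluationPoint M em
    ; inverseʳ = λ M P → let open ProductProperties M in
        Setoid.sym (pointSetoid (Product M)) {P} {evaluationPoint em (location em P)} (P≈evaluation-location em P)
    }

  counit : NaturalIsomorphism (ProductF ∘F SpecF) idF
  counit = record
    { η        = λ (A , profinite) →
        evaluate A , IsomorphismProperties.reflects (evaluate A) (evaluate-profinite profinite)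
    ; η⁻¹      = λ (A , profinite) → let open IsomorphismProperties (evaluate A) (evaluate-profinite profinite) in
        inverse , IsomorphismProperties.reflects inverse inverse-isIsomorphism
    -- The ratio of `restriction` at `P` is the scale of the normalisation, so naturality is the
    -- equation defining that scale.
    ; natural  = λ (φ , φ-r) b P → ≡.sym (Classical.Normalisation.val≡scale*val (normalisedPullback φ φ-r P) b)
    ; inverseˡ = λ (A , profinite) → IsomorphismProperties.to∘from (evaluate A) (evaluate-profinite profinite)
    ; inverseʳ = λ (A , profinite) → IsomorphismProperties.from∘to (evaluate A) (evaluate-profinite profinite)
    }

corollary4p6 : (ℓ : Level) → ExcludedMiddle (Level.suc ℓ) → Equivalence (𝕄 ℓ) ((ℙ ℓ) ᵒᵖ)
corollary4p6 ℓ em = record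
  { F      = ProductF em′
  ; G      = SpecF em′
  ; unit   = unit em′
  ; counit = counit em′
  }
  where
  em′ : ExcludedMiddle ℓ
  em′ = Dec.map′ lower lift (em {Lift (Level.suc ℓ) _})
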